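{- Let $k\ge1$, $n\ge0$. The set of walks of length $n$ in $W_k=\{(x_1,\dots,x_k)\in\mathbb Z^k:x_1>x_2>\dots>x_k>0\}$ with steps in $\{\pm e_1,\dots,\pm e_k\}$, starting at $(k,k-1,\dots,1)$ and ending in $\{(k,k-1,\dots,1)+m e_1: m\ge0\}$, is in bijection with the set of walks of length $n$ in $W_{2k}=\{(x_1,\dots,x_{2k})\in\mathbb Z^{2k}:x_1>\dots>x_{2k}>0\}$ with steps in $\{e_1,\dots,e_{2k}\}$ only, starting at $(2k,2k-1,\dots,1)$ and ending anywhere in $W_{2k}$.
   Context: $e_i$ denotes the $i$th standard unit vector; walks must stay in the indicated region at every step. -}

module Defs where

open import Data.Nat using (ℕ; zero; suc; _∸_; _≡ᵇ_)
open import Data.Integer using (ℤ; +_; -_; _+_; _*_; _<_; _>_)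
open import Data.Fin using (Fin; toℕ)
open import Data.Bool using (Bool; true; false; if_then_else_)
open import Data.Vec using (Vec; []; _∷_; tabulate; zipWith; last)
open import Data.Vec.Relation.Unary.All using (All)
open import Data.Vec.Relation.Unary.Linked using (Linked)
open import Data.Unit using (⊤)
open import Data.Product using (Σ; ∃; _×_)
open import Relation.Binary.PropositionalEquality using (_≡_)

Point : ℕ → Set
Point k = Vec ℤ k

InW : {k : ℕ} → Point k → Set
InW x = Linked _>_ x × All (λ xi → + 0 < xi) x

-- Standard unit vector e_i (i is 0-based: Fin index 0 is e_1).
e : {k : ℕ} → Fin k → Point k
e i = tabulate (λ j → if toℕ i ≡ᵇ toℕ j then + 1 else + 0)

_⊕_ : {k : ℕ} → Point k → Point k → Point k
_⊕_ = zipWith _+_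

start : (k : ℕ) → Point k
start k = tabulate (λ i → + (k ∸ toℕ i))

-- First unit vector e_1 (zero vector if k = 0; theorem assumes k ≥ 1).
e₁ : (k : ℕ) → Point k
e₁ k = tabulate (λ j → if toℕ j ≡ᵇ 0 then + 1 else + 0)

PMStep : ℕ → Set
PMStep k = Fin k × Bool

pmDisp : {k : ℕ} → PMStep k → Point k
pmDisp (i Data.Product., true)  = e i
pmDisp (i Data.Product., false) = Data.Vec.map -_ (e i)

PStep : ℕ → Set
PStep k = Fin k

pDisp : {k : ℕ} → PStep k → Point k
pDisp i = e i

positions : {k n : ℕ} {S : Set} → (S → Point k) → Point k → Vec S n → Vec (Point k) (suc n)
positions disp s []       = s ∷ []
positions disp s (t ∷ w)  = s ∷ positions disp (s ⊕ disp t) w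

Walk : (k n : ℕ) {S : Set} → (S → Point k) → Point k → (Point k → Set) → Set
Walk k n {S} disp s End =
  Σ (Vec S n) (λ w → All InW (positions disp s w) × End (last (positions disp s w)))

OnRay : (k : ℕ) → Point k → Set
OnRay k x = ∃ (λ (m : ℕ) → x ≡ start k ⊕ Data.Vec.map (λ c → + m * c) (e₁ k))

-- No endpoint restriction (beyond lying in W, already required).
Anywhere : {k : ℕ} → Point k → Set
Anywhere _ = ⊤

{-# OPTIONS --safe #-}

-- A walk in the type C chamber is an oscillating tableau with at most k rows.
-- Read through the heights of its columns, it encodes a matching with open arcs
-- that has no k + 1 nested arcs (Chen, Deng, Du, Stanley, Yan).  If the walk ends
-- in a row of length m, then m further deletions close the open arcs, and these
-- are recognised by being made from right to left.  A perfect matching, as a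
-- fixed-point-free involution, corresponds under the Robinson-Schensted map to a
-- standard tableau with columns of even length (computed by Beissinger's rule).
-- By the bumping lemma the m deletions become a horizontal strip, and every
-- tableau with at most 2k rows is completed to even columns by a unique such
-- strip.  Both maps run on the same word: deleting a box sweeps leftwards over the
-- open arcs and the induced insertion sweeps rightwards over the closed ones.

module Submission where

open import Axiom.UniquenessOfIdentityProofs.WithK using (uip)
open import Defs
open import Data.Bool using (true; false)
open import Data.Empty using (⊥-elim)
open import Data.Fin using (Fin; zero; suc; toℕ; fromℕ<)
open import Data.Fin.Properties using (toℕ<n; toℕ-injective; toℕ-fromℕ<)
import Data.Integer as ℤ
open ℤ using (ℤ; +<+)
import Data.Integer.Properties as ℤₚ
open import Data.Nat
open import Data.Nat.Properties
open import Data.Product using (Σ; ∃; ∃₂; _×_; _,_; proj₁; proj₂)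
import Data.Sum as Sum
open import Data.Sum using (_⊎_; inj₁; inj₂)
open import Data.Unit using (⊤; tt)
open import Data.Vec using (Vec; []; _∷_; _∷ʳ_; map; _++_; replicate; reverse; last; tabulate)
open import Data.Vec.Properties
  using (++-injective; ∷-injective; reverse-involutive; reverse-∷; last-∷ʳ; reverse-injective; map-∘; tabulate-∘)
open import Data.Vec.Relation.Unary.All as All using (All; []; _∷_)
open import Data.Vec.Relation.Unary.Linked as Linked using (Linked; []; [-]; _∷_)
open import Function.Base using (_∘_)
open import Function.Bundles using (_↔_; mk↔ₛ′)
open import Relation.Binary.Definitions using (tri<; tri≈; tri>)
open import Relation.Binary.PropositionalEquality
open import Relation.Nullary using (¬_; Dec; yes; no; Irrelevant)

-- A tableau is kept only as a lattice word: the letter at a position names the row or column of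
-- that entry. Deleting a box is then reverse column bumping among the letters `○`, inserting the
-- left end that it expels is row bumping among the letters `●`, and the expelled position is the
-- only contact between the two. Since exchanging the colours reverses a sweep, determinism of
-- sweeps gives injectivity and existence gives surjectivity. The obstacle is the height bound: it
-- concerns all intermediate shapes on one side and only the final tableau on the other. Together
-- with their mirror images, k + 1 nested arcs form a decreasing sequence of length 2k + 2 in the
-- involution, which is the origin of the factor 2. Each passage to Viennot's shadows shortens such
-- a sequence by one point, so nested arcs become visible as large row labels. This needs to know
-- when each label was acquired, hence the passage from single words to histories of words. The free
-- walk consists of the letters older than the strip, as they stand once all arcs are closed.

-- Shapes as weakly decreasing functions.

δ : ℕ → ℕ → ℕ
δ zero    zero    = 1
δ zero    (suc _) = 0
δ (suc _) zero    = 0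
δ (suc i) (suc j) = δ i j

δ-refl : ∀ i → δ i i ≡ 1
δ-refl zero    = refl
δ-refl (suc i) = δ-refl i

δ-≢ : ∀ {i j} → i ≢ j → δ i j ≡ 0
δ-≢ {zero}  {zero}  ne = ⊥-elim (ne refl)
δ-≢ {zero}  {suc j} ne = refl
δ-≢ {suc i} {zero}  ne = refl
δ-≢ {suc i} {suc j} ne = δ-≢ (ne ∘ cong suc)

Desc : (ℕ → ℕ) → Set
Desc f = ∀ i → f (suc i) ≤ f i

Addable Removable : (ℕ → ℕ) → ℕ → Set
Addable   f c = ∀ i → c ≡ suc i → f c < f i
Removable f c = f (suc c) < f c

desc-add : ∀ {f g c} → Desc f → Addable f c → (∀ i → g i ≡ δ i c + f i) → Desc g
desc-add {f} {g} {c} d ad eq i rewrite eq (suc i) | eq i with suc i ≟ c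
... | yes refl rewrite δ-refl i = ≤-trans (ad i refl) (m≤n+m (f i) (δ i (suc i)))
... | no  i≢c  rewrite δ-≢ i≢c  = ≤-trans (d i) (m≤n+m (f i) (δ i c))

desc-remove : ∀ {f g c} → Desc f → Removable f c → (∀ i → f i ≡ δ i c + g i) → Desc g
desc-remove {f} {g} {c} d rm eq i with i ≟ c
... | yes refl = s≤s⁻¹ (subst₂ _<_ (trans (eq (suc i)) (cong (_+ g (suc i)) (δ-≢ {suc i} {i} λ ())))
                                   (trans (eq i) (cong (_+ g i) (δ-refl i))) rm)
... | no  i≢c  = ≤-trans (m≤n+m (g (suc i)) (δ (suc i) c))
                   (subst₂ _≤_ (eq (suc i)) (trans (eq i) (cong (_+ g i) (δ-≢ i≢c))) (d i))

-- Words list the newest letter first.  A letter ○ x is an arc still open, whose box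
-- is in column x of the oscillating tableau; ● y is an end of a closed arc, whose box
-- is in row y of the standard tableau.  Rows and columns are numbered from 0.
data Letter : Set where
  ○ ● : ℕ → Letter

Word : ℕ → Set
Word = Vec Letter

#○ #● : ∀ {n} → Word n → ℕ → ℕ
#○ []        i = 0
#○ (○ x ∷ w) i = δ i x + #○ w i
#○ (● _ ∷ w) i = #○ w i
#● []        i = 0
#● (○ _ ∷ w) i = #● w i
#● (● y ∷ w) i = δ i y + #● w i

-- The lattice (Yamanouchi) condition for one colour: the letters of that colour encode a standard
-- tableau whose entries are their positions.
Yam : (∀ {n} → Word n → ℕ → ℕ) → ∀ {n} → Word n → Set
Yam # []      = Desc (# [])
Yam # (l ∷ w) = Desc (# (l ∷ w)) × Yam # w

yam-desc : ∀ (# : ∀ {n} → Word n → ℕ → ℕ) {n} (w : Word n) → Yam # w → Desc (# w)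
yam-desc # []      y = y
yam-desc # (l ∷ w) y = proj₁ y

flip : Letter → Letter
flip (○ x) = ● x
flip (● y) = ○ y

flips : ∀ {n} → Word n → Word n
flips = map flip

flips-involutive : ∀ {n} (w : Word n) → flips (flips w) ≡ w
flips-involutive []        = refl
flips-involutive (○ x ∷ w) = cong (○ x ∷_) (flips-involutive w)
flips-involutive (● x ∷ w) = cong (● x ∷_) (flips-involutive w)

#○-flips : ∀ {n} (w : Word n) i → #○ (flips w) i ≡ #● w i
#○-flips []        i = refl
#○-flips (○ x ∷ w) i = #○-flips w i
#○-flips (● x ∷ w) i = cong (δ i x +_) (#○-flips w i)

#●-flips : ∀ {n} (w : Word n) i → #● (flips w) i ≡ #○ w i
#●-flips []        i = refl
#●-flips (○ x ∷ w) i = cong (δ i x +_) (#●-flips w i)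
#●-flips (● x ∷ w) i = #●-flips w i

desc-≗ : ∀ {f g} → (∀ i → f i ≡ g i) → Desc f → Desc g
desc-≗ eq d i = subst₂ _≤_ (eq (suc i)) (eq i) (d i)

yam○-flips : ∀ {n} (w : Word n) → Yam #● w → Yam #○ (flips w)
yam○-flips []      y       = λ _ → z≤n
yam○-flips (l ∷ w) (d , y) = desc-≗ (λ i → sym (#○-flips (l ∷ w) i)) d , yam○-flips w y

yam●-flips : ∀ {n} (w : Word n) → Yam #○ w → Yam #● (flips w)
yam●-flips []      y       = λ _ → z≤n
yam●-flips (l ∷ w) (d , y) = desc-≗ (λ i → sym (#●-flips (l ∷ w) i)) d , yam●-flips w y

-- Sweep c w w′ j: the local rules of a growth diagram along one row.  On the way in, the
-- column c of the deleted box decreases at each ○ it equals, until it closes the arc ○ 0;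
-- on the way out, a row index grows from 0 to j by bumping each ● it equals.
data Sweep : ∀ {n} → ℕ → Word n → Word n → ℕ → Set where
  turn   : ∀ {n} {w : Word n} → Sweep 0 (○ 0 ∷ w) (● 0 ∷ w) 0
  ○-hit  : ∀ {n c j} {w w′ : Word n} → Sweep c w w′ j → Sweep (suc c) (○ (suc c) ∷ w) (○ c ∷ w′) j
  ○-pass : ∀ {n c j x} {w w′ : Word n} → x ≢ c → Sweep c w w′ j → Sweep c (○ x ∷ w) (○ x ∷ w′) j
  ●-hit  : ∀ {n c j} {w w′ : Word n} → Sweep c w w′ j → Sweep c (● j ∷ w) (● (suc j) ∷ w′) (suc j)
  ●-pass : ∀ {n c j y} {w w′ : Word n} → y ≢ j → Sweep c w w′ j → Sweep c (● y ∷ w) (● y ∷ w′) j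

-- The rules are symmetric under exchanging colours and directions, hence reversible.
sweep-flip : ∀ {n c j} {w w′ : Word n} → Sweep c w w′ j → Sweep j (flips w′) (flips w) c
sweep-flip turn         = turn
sweep-flip (○-hit s)    = ●-hit (sweep-flip s)
sweep-flip (○-pass p s) = ●-pass p (sweep-flip s)
sweep-flip (●-hit s)    = ○-hit (sweep-flip s)
sweep-flip (●-pass p s) = ○-pass p (sweep-flip s)

sweep-flip⁻¹ : ∀ {n c j} {w w′ : Word n} → Sweep j (flips w′) w c → Sweep c (flips w) w′ j
sweep-flip⁻¹ {c = c} {j} {w} {w′} s = subst (λ v → Sweep c (flips w) v j) (flips-involutive w′) (sweep-flip s)

sweep-functional : ∀ {n c j₁ j₂} {w w₁ w₂ : Word n} →
  Sweep c w w₁ j₁ → Sweep c w w₂ j₂ → w₁ ≡ w₂ × j₁ ≡ j₂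
sweep-functional turn         turn         = refl , refl
sweep-functional turn         (○-pass p _) = ⊥-elim (p refl)
sweep-functional (○-pass p _) turn         = ⊥-elim (p refl)
sweep-functional (○-hit s)    (○-hit t)    with refl , refl ← sweep-functional s t = refl , refl
sweep-functional (○-hit s)    (○-pass p _) = ⊥-elim (p refl)
sweep-functional (○-pass p _) (○-hit _)    = ⊥-elim (p refl)
sweep-functional (○-pass _ s) (○-pass _ t) with refl , refl ← sweep-functional s t = refl , refl
sweep-functional (●-hit s)    (●-hit t)    with refl , refl ← sweep-functional s t = refl , refl
sweep-functional (●-hit s)    (●-pass p t) with refl , refl ← sweep-functional s t = ⊥-elim (p refl)
sweep-functional (●-pass p s) (●-hit t)    with refl , refl ← sweep-functional s t = ⊥-elim (p refl)
sweep-functional (●-pass _ s) (●-pass _ t) with refl , refl ← sweep-functional s t = refl , refl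

sweep-injective : ∀ {n c₁ c₂ j} {w₁ w₂ w′ : Word n} →
  Sweep c₁ w₁ w′ j → Sweep c₂ w₂ w′ j → w₁ ≡ w₂ × c₁ ≡ c₂
sweep-injective {w₁ = w₁} {w₂} s t with sweep-functional (sweep-flip s) (sweep-flip t)
... | eq , c≡ = trans (sym (flips-involutive w₁)) (trans (cong flips eq) (flips-involutive w₂)) , c≡

+-swap : ∀ a b c → a + (b + c) ≡ b + (a + c)
+-swap a b c = trans (sym (+-assoc a b c)) (trans (cong (_+ c) (+-comm a b)) (+-assoc b a c))

-- A letter moved into a column by a hit makes up for the one that this column loses further in, so
-- only the starting column has a net loss.
sweep-#○ : ∀ {n c j} {w w′ : Word n} → Sweep c w w′ j → ∀ i → #○ w i ≡ δ i c + #○ w′ i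
sweep-#○ turn i = refl
sweep-#○ (○-hit {c = c} s) i = cong (δ i (suc c) +_) (sweep-#○ s i)
sweep-#○ (○-pass {c = c} {x = x} {w′ = w′} _ s) i =
  trans (cong (δ i x +_) (sweep-#○ s i)) (+-swap (δ i x) (δ i c) (#○ w′ i))
sweep-#○ (●-hit s) i = sweep-#○ s i
sweep-#○ (●-pass _ s) i = sweep-#○ s i

sweep-#● : ∀ {n c j} {w w′ : Word n} → Sweep c w w′ j → ∀ i → #● w′ i ≡ δ i j + #● w i
sweep-#● {j = j} {w} {w′} s i =
  trans (sym (#○-flips w′ i)) (trans (sweep-#○ (sweep-flip s) i) (cong (δ i j +_) (#○-flips w i)))

removable-tail○ : ∀ {n c x} {w : Word n} → x ≢ c → Removable (#○ (○ x ∷ w)) c → Removable (#○ w) c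
removable-tail○ {c = c} {x} {w} x≢c r =
  ≤-trans (s≤s (m≤n+m (#○ w (suc c)) (δ (suc c) x)))
          (subst (λ z → δ (suc c) x + #○ w (suc c) < z + #○ w c) (δ-≢ (x≢c ∘ sym)) r)

removable-hit○ : ∀ {n c} {w : Word n} → Desc (#○ (○ (suc c) ∷ w)) → Removable (#○ w) c
removable-hit○ {c = c} {w} d =
  subst₂ (λ y z → y + #○ w (suc c) ≤ z + #○ w c) (δ-refl c) (δ-≢ {c} {suc c} λ ()) (d c)

-- Removability passes to the older letters: at a pass the count of `suc c` can only drop, and at a
-- hit the lattice condition for the letter hit gives it for the next column. An empty word has
-- nothing to remove, so the sweep must turn.
sweep-exists : ∀ {n c} (w : Word n) → Yam #○ w → Removable (#○ w) c →
  ∃₂ λ w′ j → Sweep c w w′ j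
sweep-exists {c = c} (○ x ∷ w) (d , y) r with x ≟ c
sweep-exists {c = zero} (○ x ∷ w) (d , y) r | yes refl = _ , _ , turn
sweep-exists {c = suc c} (○ x ∷ w) (d , y) r | yes refl =
  let w′ , j , s = sweep-exists w y (removable-hit○ {w = w} d) in _ , _ , ○-hit s
sweep-exists (○ x ∷ w) (d , y) r | no x≢c =
  let w′ , j , s = sweep-exists w y (removable-tail○ {w = w} x≢c r) in _ , _ , ○-pass x≢c s
sweep-exists (● y ∷ w) (d , ya) r with sweep-exists w ya r
... | w′ , j , s with y ≟ j
... | yes refl = _ , _ , ●-hit s
... | no  y≢j  = _ , _ , ●-pass y≢j s

sweep-yam○ : ∀ {n c j} {w w′ : Word n} → Sweep c w w′ j →
  Yam #○ w → Removable (#○ w) c → Yam #○ w′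
sweep-yam○ turn (d , y) r = desc-remove d r (λ _ → refl) , y
sweep-yam○ t@(○-hit {w = w} s) (d , y) r =
  desc-remove d r (sweep-#○ t) , sweep-yam○ s y (removable-hit○ {w = w} d)
sweep-yam○ t@(○-pass {w = w} p s) (d , y) r =
  desc-remove d r (sweep-#○ t) , sweep-yam○ s y (removable-tail○ {w = w} p r)
sweep-yam○ t@(●-hit s)    (d , y) r = desc-remove d r (sweep-#○ t) , sweep-yam○ s y r
sweep-yam○ t@(●-pass _ s) (d , y) r = desc-remove d r (sweep-#○ t) , sweep-yam○ s y r

sweep-addable : ∀ {n c j} {w w′ : Word n} → Sweep c w w′ j → Yam #● w → Addable (#● w) j
sweep-addable turn         y       i ()
sweep-addable (○-hit s)    (d , y) i eq = sweep-addable s y i eq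
sweep-addable (○-pass _ s) (d , y) i eq = sweep-addable s y i eq
sweep-addable (●-hit {j = j} {w = w} s) (d , y) i refl rewrite δ-refl j | δ-≢ {suc j} {j} (λ ()) =
  s≤s (yam-desc #● w y j)
sweep-addable (●-pass {j = j} {y = x} {w = w} p s) (d , y) i refl rewrite δ-≢ (p ∘ sym) =
  ≤-trans (sweep-addable s y i refl) (m≤n+m (#● w i) (δ i x))

sweep-yam● : ∀ {n c j} {w w′ : Word n} → Sweep c w w′ j → Yam #● w → Yam #● w′
sweep-yam● {w = _ ∷ _} {_ ∷ _} t y = desc-add (proj₁ y) (sweep-addable t y) (sweep-#● t) , rest t y
  where
  rest : ∀ {n c j l l′} {w w′ : Word n} → Sweep c (l ∷ w) (l′ ∷ w′) j → Yam #● (l ∷ w) → Yam #● w′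
  rest turn         (_ , y) = y
  rest (○-hit s)    (_ , y) = sweep-yam● s y
  rest (○-pass _ s) (_ , y) = sweep-yam● s y
  rest (●-hit s)    (_ , y) = sweep-yam● s y
  rest (●-pass _ s) (_ , y) = sweep-yam● s y

-- The row bumping lemma.
two-sweeps : ∀ {n c₁ c₂ j₁ j₂} {w w′ w″ : Word n} → Sweep c₁ w w′ j₁ → Sweep c₂ w′ w″ j₂ →
  (c₂ < c₁ → j₂ ≤ j₁) × (c₁ ≤ c₂ → j₁ < j₂)
two-sweeps turn (●-hit t) = (λ ()) , λ _ → s≤s z≤n
two-sweeps turn (●-pass p t) = (λ ()) , λ _ → n≢0⇒n>0 (p ∘ sym)
two-sweeps (○-hit s) turn = (λ _ → z≤n) , λ ()
two-sweeps (○-hit s) (○-hit t) with two-sweeps s t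
... | f , g = (λ _ → f ≤-refl) , λ le → ⊥-elim (<-irrefl refl le)
two-sweeps (○-hit s) (○-pass p t) with two-sweeps s t
... | f , g = (λ lt → f (≤∧≢⇒< (s≤s⁻¹ lt) (p ∘ sym))) , λ le → g (≤-trans (n≤1+n _) le)
two-sweeps (○-pass p s) turn = (λ _ → z≤n) , λ le → ⊥-elim (p (sym (n≤0⇒n≡0 le)))
two-sweeps (○-pass p s) (○-hit t) with two-sweeps s t
... | f , g = (λ lt → f (<⇒≤ lt)) , λ le → g (s≤s⁻¹ (≤∧≢⇒< le (p ∘ sym)))
two-sweeps (○-pass p s) (○-pass q t) = two-sweeps s t
two-sweeps (●-hit s) (●-hit t) with two-sweeps s t
... | f , g = (λ lt → ⊥-elim (<-irrefl refl (f lt))) , λ le → s≤s (g le)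
two-sweeps (●-hit s) (●-pass p t) with two-sweeps s t
... | f , g = (λ lt → ≤-trans (f lt) (n≤1+n _)) , λ le → ≤∧≢⇒< (g le) p
two-sweeps (●-pass p s) (●-hit t) with two-sweeps s t
... | f , g = (λ lt → ≤∧≢⇒< (f lt) p) , λ le → ≤-trans (g le) (n≤1+n _)
two-sweeps (●-pass p s) (●-pass q t) = two-sweeps s t

-- Oscillating tableaux and their runs

data Step : Set where
  add del : ℕ → Step

-- The subtraction is exact on the sequences satisfying Osc.
col : ∀ {n} → Vec Step n → ℕ → ℕ
col []          i = 0
col (add c ∷ s) i = δ i c + col s i
col (del c ∷ s) i = col s i ∸ δ i c

Osc : ∀ {n} → Vec Step n → Set
Osc []          = ⊤
Osc (add c ∷ s) = Addable (col s) c × Osc s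
Osc (del c ∷ s) = Removable (col s) c × Osc s

-- The box of the right end of an arc goes one row below the box created by inserting its
-- left end (Beissinger's rule for two-cycles).
data Run : ∀ {n} → Vec Step n → Word n → Set where
  []  : Run [] []
  add : ∀ {n c} {s : Vec Step n} {w} → Run s w → Run (add c ∷ s) (○ c ∷ w)
  del : ∀ {n c j} {s : Vec Step n} {w w′} → Run s w → Sweep c w w′ j →
        Run (del c ∷ s) (● (suc j) ∷ w′)

run-functional : ∀ {n} {s : Vec Step n} {w₁ w₂} → Run s w₁ → Run s w₂ → w₁ ≡ w₂
run-functional []        []        = refl
run-functional (add r)   (add q)   = cong (_ ∷_) (run-functional r q)
run-functional (del r s) (del q t) with refl ← run-functional r q
                                   with refl , refl ← sweep-functional s t = refl

run-injective : ∀ {n} {s₁ s₂ : Vec Step n} {w} → Run s₁ w → Run s₂ w → s₁ ≡ s₂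
run-injective []        []        = refl
run-injective (add r)   (add q)   = cong (_ ∷_) (run-injective r q)
run-injective (del r s) (del q t) with refl , refl ← sweep-injective s t =
  cong (_ ∷_) (run-injective r q)

run-col : ∀ {n} {s : Vec Step n} {w} → Run s w → ∀ i → #○ w i ≡ col s i
run-col []                i = refl
run-col (add {c = c} r)   i = cong (δ i c +_) (run-col r i)
run-col (del {c = c} {w′ = w′} r s) i = sym (trans
  (cong (_∸ δ i c) (trans (sym (run-col r i)) (sweep-#○ s i)))
  (m+n∸m≡n (δ i c) (#○ w′ i)))

-- Shapes with even columns.

dbl : ℕ → ℕ
dbl zero    = zero
dbl (suc i) = suc (suc (dbl i))

-- All columns have even length.
Paired : (ℕ → ℕ) → Set
Paired f = ∀ i → f (dbl i) ≡ f (suc (dbl i))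

data Parity : ℕ → Set where
  even : ∀ i → Parity (dbl i)
  odd  : ∀ i → Parity (suc (dbl i))

parity? : ∀ n → Parity n
parity? zero = even 0
parity? (suc n) with parity? n
... | even i = odd i
... | odd  i = even (suc i)

dbl-≢ : ∀ i k → dbl i ≢ suc (dbl k)
dbl-≢ (suc i) (suc k) eq = dbl-≢ i k (suc-injective (suc-injective eq))

-- The lower row of an equal pair cannot be lengthened unless the upper one is, so `j` is even and
-- the two boxes lengthen both rows of one pair. This is why placing the right end one row further
-- down preserves even columns.
paired-add : ∀ {f h g : ℕ → ℕ} {j} → Desc f → Desc g → (∀ i → h i ≡ δ i j + f i) →
  (∀ i → g i ≡ δ i (suc j) + h i) → Paired f → Paired g
paired-add {f} {h} {g} {j} df dg eq eq′ pf i with parity? j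
... | even k rewrite eq′ (dbl i) | eq′ (suc (dbl i)) | eq (dbl i) | eq (suc (dbl i))
                   | δ-≢ (dbl-≢ i k) | δ-≢ (dbl-≢ k i ∘ sym) = cong (δ (dbl i) (dbl k) +_) (pf i)
... | odd  k = ⊥-elim (<-irrefl refl (≤-trans (≤-reflexive lower) (≤-trans (dg (dbl k)) (≤-reflexive upper))))
  where
  lower : suc (f (dbl k)) ≡ g (suc (dbl k))
  lower rewrite eq′ (suc (dbl k)) | eq (suc (dbl k)) | δ-≢ {dbl k} {suc (dbl k)} (λ e → 1+n≢n (sym e))
              | δ-refl (dbl k) = cong suc (pf k)
  upper : g (dbl k) ≡ f (dbl k)
  upper rewrite eq′ (dbl k) | eq (dbl k) | δ-≢ {dbl k} {suc (suc (dbl k))} (λ e → m≢1+n+m (dbl k) {1} e)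
              | δ-≢ (dbl-≢ k k) = refl

-- An odd `j` would make `suc j` the upper row of a pair; equality in `g` would then make the lower
-- row of that pair the longer one in `h`.
paired-remove : ∀ {f h g : ℕ → ℕ} {j} → Desc h → (∀ i → h i ≡ δ i j + f i) →
  (∀ i → g i ≡ δ i (suc j) + h i) → Paired g → Paired f
paired-remove {f} {h} {g} {j} dh eq eq′ pg i with parity? j
... | even k = +-cancelˡ-≡ (δ (dbl i) (dbl k)) _ _ (trans (sym lhs) (trans (pg i) rhs))
  where
  lhs : g (dbl i) ≡ δ (dbl i) (dbl k) + f (dbl i)
  lhs rewrite eq′ (dbl i) | eq (dbl i) | δ-≢ (dbl-≢ i k) = refl
  rhs : g (suc (dbl i)) ≡ δ (dbl i) (dbl k) + f (suc (dbl i))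
  rhs rewrite eq′ (suc (dbl i)) | eq (suc (dbl i)) | δ-≢ (dbl-≢ k i ∘ sym) = refl
... | odd  k = ⊥-elim (<-irrefl refl (≤-trans (≤-reflexive (trans (sym lower) (trans (pg (suc k)) upper))) (dh (dbl (suc k)))))
  where
  lower : g (dbl (suc k)) ≡ suc (h (dbl (suc k)))
  lower rewrite eq′ (dbl (suc k)) | δ-refl (dbl (suc k)) = refl
  upper : g (suc (dbl (suc k))) ≡ h (suc (dbl (suc k)))
  upper rewrite eq′ (suc (dbl (suc k))) | δ-≢ {suc (dbl k)} {dbl k} 1+n≢n = refl

paired-no-zero : ∀ {f g} → Desc f → (∀ i → g i ≡ δ i 0 + f i) → ¬ Paired g
paired-no-zero d eq pg =
  <-irrefl refl (≤-trans (≤-reflexive (trans (sym (eq 0)) (trans (pg 0) (eq 1)))) (d 0))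

-- These conditions characterise the words produced by oscillating sequences: `osc-run` and
-- `good-run` are the two directions.
record Good {n} (w : Word n) : Set where
  constructor good
  field
    yam○   : Yam #○ w
    yam●   : Yam #● w
    paired : Paired (#● w)

open Good public

removable-≗ : ∀ {f g c} → (∀ i → f i ≡ g i) → Removable f c → Removable g c
removable-≗ {c = c} eq = subst₂ _<_ (eq (suc c)) (eq c)

addable-≗ : ∀ {f g c} → (∀ i → f i ≡ g i) → Addable f c → Addable g c
addable-≗ {c = c} eq ad i e = subst₂ _<_ (eq c) (eq i) (ad i e)

desc-addable : ∀ {f g c} → Desc g → (∀ i → g i ≡ δ i c + f i) → Addable f c
desc-addable {f} {c = c} d eq i refl =
  subst₂ _≤_ (trans (eq (suc i)) (cong (_+ f (suc i)) (δ-refl i)))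
             (trans (eq i) (cong (_+ f i) (δ-≢ {i} {suc i} (λ e → 1+n≢n (sym e))))) (d i)

desc-removable : ∀ {f g c} → Desc f → (∀ i → g i ≡ δ i c + f i) → Removable g c
desc-removable {f} {c = c} d eq =
  subst₂ _<_ (sym (trans (eq (suc c)) (cong (_+ f (suc c)) (δ-≢ {suc c} {c} 1+n≢n))))
             (sym (trans (eq c) (cong (_+ f c) (δ-refl c)))) (s≤s (d c))

cons-addable : ∀ {f g j} → Desc f → (∀ i → g i ≡ δ i j + f i) → Addable g (suc j)
cons-addable d eq i refl = desc-removable d eq

osc-run : ∀ {n} (s : Vec Step n) → Osc s → ∃ λ w → Run s w × Good w
osc-run [] o = [] , [] , good (λ _ → z≤n) (λ _ → z≤n) (λ _ → refl)
osc-run (add c ∷ s) (a , o) with osc-run s o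
... | w , r , good y○ y● p = _ , add r , good
  (desc-add (yam-desc #○ w y○) (addable-≗ (λ i → sym (run-col r i)) a) (λ _ → refl) , y○)
  (yam-desc #● w y● , y●) p
osc-run (del c ∷ s) (a , o) with osc-run s o
... | w , r , good y○ y● p with sweep-exists w y○ rm
  where rm = removable-≗ (λ i → sym (run-col r i)) a
... | w′ , j , sw = _ , del r sw , good
  (yam-desc #○ w′ y○′ , y○′) (d′ , y●′)
  (paired-add (yam-desc #● w y●) d′ (sweep-#● sw) (λ _ → refl) p)
  where
  y○′ = sweep-yam○ sw y○ (removable-≗ (λ i → sym (run-col r i)) a)
  y●′ = sweep-yam● sw y●
  d′ : Desc (#● (● (suc j) ∷ w′))
  d′ = desc-add (yam-desc #● w′ y●′) (cons-addable (yam-desc #● w y●) (sweep-#● sw)) (λ _ → refl)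

unsweep-exists : ∀ {n j} (w′ : Word n) → Yam #● w′ → Removable (#● w′) j →
  ∃₂ λ w c → Sweep c w w′ j
unsweep-exists w′ y r with sweep-exists (flips w′) (yam○-flips w′ y) (removable-≗ (λ i → sym (#○-flips w′ i)) r)
... | v , c , s = flips v , c , sweep-flip⁻¹ s

unsweep-yam● : ∀ {n c j} {w w′ : Word n} → Sweep c w w′ j →
  Yam #● w′ → Removable (#● w′) j → Yam #● w
unsweep-yam● {w = w} {w′} s y r = subst (Yam #●) (flips-involutive w) (yam●-flips (flips w)
  (sweep-yam○ (sweep-flip s) (yam○-flips w′ y) (removable-≗ (λ i → sym (#○-flips w′ i)) r)))

unsweep-yam○ : ∀ {n c j} {w w′ : Word n} → Sweep c w w′ j → Yam #○ w′ → Yam #○ w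
unsweep-yam○ {w = w} {w′} s y = subst (Yam #○) (flips-involutive w) (yam○-flips (flips w)
  (sweep-yam● (sweep-flip s) (yam●-flips w′ y)))

good-run : ∀ {n} (w : Word n) → Good w → ∃ λ s → Run s w × Osc s
good-run [] g = [] , [] , tt
good-run (○ c ∷ w) (good (d , y○) (_ , y●) p) with good-run w (good y○ y● p)
... | s , r , o = add c ∷ s , add r , addable-≗ (run-col r) (desc-addable d (λ _ → refl)) , o
good-run (● zero ∷ w) (good _ (_ , y●) p) = ⊥-elim (paired-no-zero (yam-desc #● w y●) (λ _ → refl) p)
good-run (● (suc j) ∷ w′) (good (_ , y○) (d , y●) p) with unsweep-exists w′ y● rm
  where
  -- Addability of a box in row `suc j` is the same inequality as removability in row `j`, so the
  -- row at which to unsweep is read off from the newest letter.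
  rm : Removable (#● w′) j
  rm = desc-addable d (λ _ → refl) j refl
... | w , c , s with good-run w (good y○′ y●′ p′)
  where
  y○′ = unsweep-yam○ s y○
  y●′ = unsweep-yam● s y● (desc-addable d (λ _ → refl) j refl)
  p′ : Paired (#● w)
  p′ = paired-remove (yam-desc #● w′ y●) (sweep-#● s) (λ _ → refl) p
... | t , r , o = del c ∷ t , del r s ,
  removable-≗ (run-col r) (desc-removable (yam-desc #○ w′ y○) (sweep-#○ s)) , o

-- Nestings

-- Positions count from the oldest letter, so they do not change as the word grows.
data _at_is_ : ∀ {n} → Word n → ℕ → Letter → Set where
  here  : ∀ {n l} {w : Word n} → (l ∷ w) at n is l
  there : ∀ {n a l x} {w : Word n} → w at a is l → (x ∷ w) at a is l

at-< : ∀ {n a l} {w : Word n} → w at a is l → a < n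
at-< here      = ≤-refl
at-< (there p) = m≤n⇒m≤1+n (at-< p)

at-functional : ∀ {n a l l′} {w : Word n} → w at a is l → w at a is l′ → l ≡ l′
at-functional here      here      = refl
at-functional here      (there q) = ⊥-elim (<-irrefl refl (at-< q))
at-functional (there p) here      = ⊥-elim (<-irrefl refl (at-< p))
at-functional (there p) (there q) = at-functional p q

at-tail : ∀ {n a l x} {w : Word n} → a < n → (x ∷ w) at a is l → w at a is l
at-tail a<n here      = ⊥-elim (<-irrefl refl a<n)
at-tail a<n (there p) = p

infix 4 _at?_is_
_at?_is_ : ∀ {n} (w : Word n) a i → Dec (w at a is ● i)
[] at? a is i = no λ ()
(l ∷ w) at? a is i with w at? a is i
... | yes p = yes (there p)
_at?_is_ {suc n} (l ∷ w) a i | no ¬p with a ≟ n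
... | no a≢n = no λ { here → a≢n refl ; (there p) → ¬p p }
(○ x ∷ w) at? a is i | no ¬p | yes refl = no λ { (there p) → ¬p p }
(● x ∷ w) at? a is i | no ¬p | yes refl with x ≟ i
... | yes refl = yes here
... | no  x≢i  = no λ { here → x≢i refl ; (there p) → ¬p p }

-- The event that entry `a` arrives in row `i`. The lengths differ because it is used both for a
-- sweep and for a whole step of a run.
New : ∀ {m n} → Word m → Word n → ℕ → ℕ → Set
New w w′ i a = w′ at a is ● i × ¬ (w at a is ● i)

Gap : ∀ {n} → Word n → ℕ → ℕ → ℕ → Set
Gap w i a b = ∀ x → a < x → x < b → ¬ (w at x is ● i)

new-there : ∀ {n i a l l′} {w w′ : Word n} → New w w′ i a → New (l ∷ w) (l′ ∷ w′) i a
new-there (p , ¬p) = there p , ¬p ∘ at-tail (at-< p)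

gap-there : ∀ {n i a b l} {w : Word n} → b ≤ n → Gap w i a b → Gap (l ∷ w) i a b
gap-there b≤n g x a<x x<b = g x a<x x<b ∘ at-tail (≤-trans x<b b≤n)

gap-cons : ∀ {n i a l} {w : Word n} → l ≢ ● i → Gap w i a n → Gap (l ∷ w) i a (suc n)
gap-cons l≢ g x a<x x<n here      = l≢ refl
gap-cons l≢ g x a<x x<n (there p) = g x a<x (at-< p) p

gap-empty : ∀ {n i a} {w : Word n} → Gap w i a (suc a)
gap-empty x a<x x≤a _ = <-irrefl refl (≤-trans a<x (s≤s⁻¹ x≤a))

not-new : ∀ {n l l′} {w : Word n} → l ≢ l′ → ¬ ((l ∷ w) at n is l′)
not-new ne here      = ne refl
not-new ne (there p) = <-irrefl refl (at-< p)

Next : ∀ {m n} → Word m → Word n → ℕ → ℕ → Set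
Next w w′ i a = ∃ λ a′ → a < a′ × New w w′ (suc i) a′ × Gap w i a a′

next-there : ∀ {n i a l l′} {w w′ : Word n} → Next w w′ i a → Next (l ∷ w) (l′ ∷ w′) i a
next-there (a′ , lt , new , gap) = a′ , lt , new-there new , gap-there (<⇒≤ (at-< (proj₁ new))) gap

-- Row insertion seen at one row: the arriving entry bumps the least larger entry of row `i`, or
-- ends the bumping route if there is none. `Gap` expresses that the bumped entry is the least one.
sweep-next : ∀ {n c j i a} {w w′ : Word n} → Sweep c w w′ j → New w w′ i a →
  Next w w′ i a ⊎ (i ≡ j × Gap w i a n)
sweep-next turn (here , _)     = inj₂ (refl , gap-empty)
sweep-next turn (there p , ¬p) = ⊥-elim (¬p (there p))
sweep-next (○-hit s) (there p , ¬p) with sweep-next s (p , ¬p ∘ there)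
... | inj₁ nx        = inj₁ (next-there nx)
... | inj₂ (eq , g)  = inj₂ (eq , gap-cons (λ ()) g)
sweep-next (○-pass _ s) (there p , ¬p) with sweep-next s (p , ¬p ∘ there)
... | inj₁ nx        = inj₁ (next-there nx)
... | inj₂ (eq , g)  = inj₂ (eq , gap-cons (λ ()) g)
sweep-next (●-hit s) (here , _) = inj₂ (refl , gap-empty)
sweep-next (●-hit s) (there p , ¬p) with sweep-next s (p , ¬p ∘ there)
... | inj₁ nx         = inj₁ (next-there nx)
... | inj₂ (refl , g) = inj₁ (_ , at-< p , (here , not-new (λ ())) , gap-there ≤-refl g)
sweep-next (●-pass _ s) (here , ¬p) = ⊥-elim (¬p here)
sweep-next (●-pass y≢j s) (there p , ¬p) with sweep-next s (p , ¬p ∘ there)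
... | inj₁ nx         = inj₁ (next-there nx)
... | inj₂ (refl , g) = inj₂ (refl , gap-cons (λ { refl → y≢j refl }) g)

Last : ∀ {n} → Word n → Word n → ℕ → ℕ → Set
Last w w′ i a = ∃ λ t → t < a × New w w′ i t × Gap w i t a

last-there : ∀ {n i a l l′} {w w′ : Word n} → a ≤ n → Last w w′ i a → Last (l ∷ w) (l′ ∷ w′) i a
last-there a≤n (t , lt , new , gap) = t , lt , new-there new , gap-there a≤n gap

last-cons : ∀ {n i l l′} {w w′ : Word n} → l ≢ ● i → Last w w′ i n → Last (l ∷ w) (l′ ∷ w′) i (suc n)
last-cons l≢ (t , lt , new , gap) = t , m≤n⇒m≤1+n lt , new-there new , gap-cons l≢ gap

sweep-last : ∀ {n c j} {w w′ : Word n} → Sweep c w w′ j → Last w w′ j n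
sweep-last turn           = _ , ≤-refl , (here , not-new (λ ())) , gap-empty
sweep-last (○-hit s)      = last-cons (λ ()) (sweep-last s)
sweep-last (○-pass _ s)   = last-cons (λ ()) (sweep-last s)
sweep-last (●-hit s)      = _ , ≤-refl , (here , not-new (λ ())) , gap-empty
sweep-last (●-pass y≢j s) = last-cons (λ { refl → y≢j refl }) (sweep-last s)

sweep-previous : ∀ {n c j i a} {w w′ : Word n} → Sweep c w w′ j → New w w′ (suc i) a → Last w w′ i a
sweep-previous turn         (there p , ¬p) = ⊥-elim (¬p (there p))
sweep-previous (○-hit s)    (there p , ¬p) = last-there (<⇒≤ (at-< p)) (sweep-previous s (p , ¬p ∘ there))
sweep-previous (○-pass _ s) (there p , ¬p) = last-there (<⇒≤ (at-< p)) (sweep-previous s (p , ¬p ∘ there))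
sweep-previous (●-hit s)    (here , _)     = last-there ≤-refl (sweep-last s)
sweep-previous (●-hit s)    (there p , ¬p) = last-there (<⇒≤ (at-< p)) (sweep-previous s (p , ¬p ∘ there))
sweep-previous (●-pass _ s) (here , ¬p)    = ⊥-elim (¬p here)
sweep-previous (●-pass _ s) (there p , ¬p) = last-there (<⇒≤ (at-< p)) (sweep-previous s (p , ¬p ∘ there))

sweep-raises : ∀ {n c j i a} {w w′ : Word n} → Sweep c w w′ j → New w w′ (suc i) a → w at a is ● i
sweep-raises turn         (there p , ¬p) = ⊥-elim (¬p (there p))
sweep-raises (○-hit s)    (there p , ¬p) = there (sweep-raises s (p , ¬p ∘ there))
sweep-raises (○-pass _ s) (there p , ¬p) = there (sweep-raises s (p , ¬p ∘ there))
sweep-raises (●-hit s)    (here , _)     = here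
sweep-raises (●-hit s)    (there p , ¬p) = there (sweep-raises s (p , ¬p ∘ there))
sweep-raises (●-pass _ s) (here , ¬p)    = ⊥-elim (¬p here)
sweep-raises (●-pass _ s) (there p , ¬p) = there (sweep-raises s (p , ¬p ∘ there))

sweep-turns : ∀ {n c j a} {w w′ : Word n} → Sweep c w w′ j → New w w′ 0 a → w at a is ○ 0
sweep-turns turn         (here , _)     = here
sweep-turns turn         (there p , ¬p) = ⊥-elim (¬p (there p))
sweep-turns (○-hit s)    (there p , ¬p) = there (sweep-turns s (p , ¬p ∘ there))
sweep-turns (○-pass _ s) (there p , ¬p) = there (sweep-turns s (p , ¬p ∘ there))
sweep-turns (●-hit s)    (there p , ¬p) = there (sweep-turns s (p , ¬p ∘ there))
sweep-turns (●-pass _ s) (here , ¬p)    = ⊥-elim (¬p here)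
sweep-turns (●-pass _ s) (there p , ¬p) = there (sweep-turns s (p , ¬p ∘ there))

sweep-shift : ∀ {n c j i a} {w w′ : Word n} → Sweep c w w′ j → w at a is ● i →
  w′ at a is ● i ⊎ w′ at a is ● (suc i)
sweep-shift turn         (there p) = inj₁ (there p)
sweep-shift (○-hit s)    (there p) = Sum.map there there (sweep-shift s p)
sweep-shift (○-pass _ s) (there p) = Sum.map there there (sweep-shift s p)
sweep-shift (●-hit s)    here      = inj₂ here
sweep-shift (●-hit s)    (there p) = Sum.map there there (sweep-shift s p)
sweep-shift (●-pass _ s) here      = inj₁ here
sweep-shift (●-pass _ s) (there p) = Sum.map there there (sweep-shift s p)

-- The open arcs in the first column over time.

-- An arc is closed only when its left end is `○ 0`. If all arcs get closed, the `d` older letters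
-- `○ 0` foretell `d` nested arcs around the one that starts at `p`.
data ZeroAt : ∀ {n} → Word n → ℕ → ℕ → Set where
  here  : ∀ {n d} {w : Word n} → d ≤ #○ w 0 → ZeroAt (○ 0 ∷ w) n d
  there : ∀ {n p d l} {w : Word n} → ZeroAt w p d → ZeroAt (l ∷ w) p d

zero-< : ∀ {n p d} {w : Word n} → ZeroAt w p d → p < n
zero-< (here _)  = ≤-refl
zero-< (there z) = m≤n⇒m≤1+n (zero-< z)

zero-count : ∀ {n p d} {w : Word n} → ZeroAt w p d → d < #○ w 0
zero-count (here d≤) = s≤s d≤
zero-count {w = ○ x ∷ w} (there z) = ≤-trans (zero-count z) (m≤n+m (#○ w 0) (δ 0 x))
zero-count {w = ● x ∷ w} (there z) = zero-count z

zero-exists : ∀ {n d} (w : Word n) → d < #○ w 0 → ∃ λ p → ZeroAt w p d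
zero-exists (○ zero    ∷ w) d< = _ , here (s≤s⁻¹ d<)
zero-exists (○ (suc x) ∷ w) d< with zero-exists w d<
... | p , z = p , there z
zero-exists (● y ∷ w)       d< with zero-exists w d<
... | p , z = p , there z

at-zero : ∀ {n p} {w : Word n} → w at p is ○ 0 → ZeroAt w p 0
at-zero here      = here z≤n
at-zero (there p) = there (at-zero p)

at-zero-suc : ∀ {n p q d} {w : Word n} → w at q is ○ 0 → ZeroAt w p d → p < q → ZeroAt w q (suc d)
at-zero-suc here      (here _)  p<q = ⊥-elim (<-irrefl refl p<q)
at-zero-suc here      (there z) p<q = here (zero-count z)
at-zero-suc (there a) (here _)  p<q = ⊥-elim (<-asym p<q (at-< a))
at-zero-suc (there a) (there z) p<q = there (at-zero-suc a z p<q)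

-- A sweep that passes `p` does so with `c` nonzero, so further in a hit creates one `○ 0` and the
-- turn consumes one: the number of older ones is kept. A sweep that turns at `p` leaves all older
-- letters alone.
sweep-zero : ∀ {n c j p d} {w w′ : Word n} → Sweep c w w′ j → ZeroAt w p d →
  ZeroAt w′ p d ⊎ (New w w′ 0 p × (∀ e → d ≡ suc e → ∃ λ q → q < p × ZeroAt w′ q e))
sweep-zero-there : ∀ {n c j p d l l′} {w w′ : Word n} → Sweep c w w′ j → ZeroAt w p d →
  ZeroAt (l′ ∷ w′) p d ⊎ (New (l ∷ w) (l′ ∷ w′) 0 p × (∀ e → d ≡ suc e → ∃ λ q → q < p × ZeroAt (l′ ∷ w′) q e))
sweep-zero-there s z with sweep-zero s z
... | inj₁ z′       = inj₁ (there z′)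
... | inj₂ (nw , f) = inj₂ (new-there nw , λ e eq → let q , q<p , z′ = f e eq in q , q<p , there z′)
sweep-zero turn (here {w = w} d≤) = inj₂ ((here , not-new (λ ())) , λ { e refl →
  let q , z = zero-exists w d≤ in q , zero-< z , there z })
sweep-zero turn         (there z) = inj₁ (there z)
sweep-zero (○-hit s)    (there z) = sweep-zero-there s z
sweep-zero (○-pass {c = c} 0≢c s) (here d≤) =
  inj₁ (here (≤-trans d≤ (≤-reflexive (trans (sweep-#○ s 0) (cong (_+ _) (δ-≢ 0≢c))))))
sweep-zero (○-pass _ s) (there z) = sweep-zero-there s z
sweep-zero (●-hit s)    (there z) = sweep-zero-there s z
sweep-zero (●-pass _ s) (there z) = sweep-zero-there s z

-- If the letter at `p` was `○ 1` before the sweep, then the older part held one more `○ 0` than it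
-- does afterwards, and one of these takes over the role of `p`.
unsweep-zero : ∀ {n c j p d} {w w′ : Word n} → Sweep c w w′ j → ZeroAt w′ p d → ∃ λ q → q ≤ p × ZeroAt w q d
unsweep-zero-there : ∀ {n c j p d l} {w w′ : Word n} → Sweep c w w′ j → ZeroAt w′ p d →
  ∃ λ q → q ≤ p × ZeroAt (l ∷ w) q d
unsweep-zero-there s z = let q , q≤p , z′ = unsweep-zero s z in q , q≤p , there z′
unsweep-zero turn (there z) = _ , ≤-refl , there z
unsweep-zero (○-hit {w = w} s) (here d≤) =
  let q , z = zero-exists w (≤-trans (s≤s d≤) (≤-reflexive (sym (sweep-#○ s 0))))
  in q , <⇒≤ (zero-< z) , there z
unsweep-zero (○-hit s)    (there z) = unsweep-zero-there s z
unsweep-zero (○-pass 0≢c s) (here d≤) =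
  _ , ≤-refl , here (≤-trans d≤ (≤-reflexive (sym (trans (sweep-#○ s 0) (cong (_+ _) (δ-≢ 0≢c))))))
unsweep-zero (○-pass _ s) (there z) = unsweep-zero-there s z
unsweep-zero (●-hit s)    (there z) = unsweep-zero-there s z
unsweep-zero (●-pass _ s) (there z) = unsweep-zero-there s z

data Move : ∀ {n} → Word n → Word (suc n) → Set where
  add : ∀ {n c} {w : Word n} → Move w (○ c ∷ w)
  del : ∀ {n c j} {w w′ : Word n} → Sweep c w w′ j → Move w (● (suc j) ∷ w′)

move-new : ∀ {n c i a} {w : Word n} → ¬ New w (○ c ∷ w) i a
move-new (there p , ¬p) = ¬p p

new-cons : ∀ {n i a l} {w w′ : Word n} → New w w′ i a → New w (l ∷ w′) i a
new-cons (p , ¬p) = there p , ¬p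

new-born : ∀ {n i} {w w′ : Word n} → New w (● i ∷ w′) i n
new-born = here , λ p → <-irrefl refl (at-< p)

move-next : ∀ {n i a} {w : Word n} {w′} → Move w w′ → New w w′ i a → a < n → Next w w′ i a
move-next add     new             _   = ⊥-elim (move-new new)
move-next (del s) (here , ¬p)     a<n = ⊥-elim (<-irrefl refl a<n)
move-next (del s) (there p , ¬p)  a<n with sweep-next s (p , ¬p)
... | inj₁ (a′ , lt , new , gap) = a′ , lt , new-cons new , gap
... | inj₂ (refl , gap)          = _ , a<n , new-born , gap

move-previous : ∀ {n i a} {w : Word n} {w′} → Move w w′ → New w w′ (suc i) a →
  ∃ λ t → t < a × New w w′ i t × Gap w i t a
move-previous add     new            = ⊥-elim (move-new new)
move-previous (del s) (here , ¬p)    with sweep-last s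
... | t , lt , new , gap = t , lt , new-cons new , gap
move-previous (del s) (there p , ¬p) with sweep-previous s (p , ¬p)
... | t , lt , new , gap = t , lt , new-cons new , gap

move-raises : ∀ {n i a} {w : Word n} {w′} → Move w w′ → New w w′ (suc i) a → a < n → w at a is ● i
move-raises add     new            _   = ⊥-elim (move-new new)
move-raises (del s) (here , ¬p)    a<n = ⊥-elim (<-irrefl refl a<n)
move-raises (del s) (there p , ¬p) a<n = sweep-raises s (p , ¬p)

move-turns : ∀ {n a} {w : Word n} {w′} → Move w w′ → New w w′ 0 a → w at a is ○ 0
move-turns add     new            = ⊥-elim (move-new new)
move-turns (del s) (there p , ¬p) = sweep-turns s (p , ¬p)

move-shift : ∀ {n i a} {w : Word n} {w′} → Move w w′ → w at a is ● i →
  w′ at a is ● i ⊎ w′ at a is ● (suc i)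
move-shift add     p = inj₁ (there p)
move-shift (del s) p = Sum.map there there (sweep-shift s p)

move-zero : ∀ {n p d} {w : Word n} {w′} → Move w w′ → ZeroAt w p d →
  ZeroAt w′ p d ⊎ (New w w′ 0 p × (∀ e → d ≡ suc e → ∃ λ q → q < p × ZeroAt w′ q e))
move-zero add     z = inj₁ (there z)
move-zero (del s) z with sweep-zero s z
... | inj₁ z′       = inj₁ (there z′)
... | inj₂ (nw , f) = inj₂ (new-cons nw , λ e eq → let q , q<p , z′ = f e eq in q , q<p , there z′)

unmove-zero : ∀ {n p d} {w : Word n} {w′} → Move w w′ → p < n → ZeroAt w′ p d → ∃ λ q → q ≤ p × ZeroAt w q d
unmove-zero add     p<n (here _)  = ⊥-elim (<-irrefl refl p<n)
unmove-zero add     p<n (there z) = _ , ≤-refl , z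
unmove-zero (del s) p<n (there z) = unsweep-zero s z

-- Shadow points and nested arcs.

module History (N : ℕ) (st : ∀ y → Word y) (move : ∀ y → y < N → Move (st y) (st (suc y))) where

  -- X 0 is the set of arcs, as points above the diagonal; X i are its iterated shadows
  -- (Viennot's skeletons), which are the points where lines of level i start.
  X : ℕ → ℕ → ℕ → Set
  X i a b = b < N × New (st b) (st (suc b)) i a

  X-≤ : ∀ {i a b} → X i a b → a ≤ b
  X-≤ (_ , p , _) = s≤s⁻¹ (at-< p)

  next : ∀ {i a b} → X i a b → a < b →
    ∃ λ a′ → a < a′ × X (suc i) a′ b × Gap (st b) i a a′
  next (b<N , new) a<b with move-next (move _ b<N) new a<b
  ... | a′ , lt , new′ , gap = a′ , lt , (b<N , new′) , gap

  previous : ∀ {i a b} → X (suc i) a b → ∃ λ t → t < a × X i t b × Gap (st b) i t a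
  previous (b<N , new) with move-previous (move _ b<N) new
  ... | t , lt , new′ , gap = t , lt , (b<N , new′) , gap

  later : ∀ {i a b} → X i a b → ∀ y → b < y → y ≤ N →
    st y at a is ● i ⊎ ∃ λ b′ → b < b′ × b′ < y × X (suc i) a b′
  later {i} {a} {b} x (suc y) b≤y y<N with b ≟ y
  ... | yes refl = inj₁ (proj₁ (proj₂ x))
  ... | no  b≢y  with later x y (≤∧≢⇒< (s≤s⁻¹ b≤y) b≢y) (<⇒≤ y<N)
  ... | inj₂ (b′ , b<b′ , b′<y , x′) = inj₂ (b′ , b<b′ , m≤n⇒m≤1+n b′<y , x′)
  ... | inj₁ p with move-shift (move y y<N) p
  ... | inj₁ p′ = inj₁ p′
  ... | inj₂ p′ = inj₂ (y , ≤∧≢⇒< (s≤s⁻¹ b≤y) b≢y , ≤-refl , y<N , p′ , ne)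
    where
    ne : ¬ (st y at a is ● (suc i))
    ne q with () ← at-functional p q

  origin : ∀ {i a} y → y ≤ N → st y at a is ● i →
    ∃ λ x → x < y × X i a x × (∀ z → x < z → z ≤ y → st z at a is ● i)
  origin zero y≤N p = ⊥-elim (n≮0 (at-< p))
  origin {i} {a} (suc y) y<N p with st y at? a is i
  ... | no ¬p = y , ≤-refl , (y<N , p , ¬p) , λ z y<z z≤y → subst (λ z → st z at a is ● i) (≤-antisym y<z z≤y) p
  ... | yes q with origin y (<⇒≤ y<N) q
  ... | x , x<y , xx , f = x , m≤n⇒m≤1+n x<y , xx , g
    where
    g : ∀ z → x < z → z ≤ suc y → st z at a is ● i
    g z x<z z≤y with z ≟ suc y
    ... | yes refl = p
    ... | no  ne   = f z x<z (s≤s⁻¹ (≤∧≢⇒< z≤y ne))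

  earlier : ∀ {i a b} → X (suc i) a b → a < b →
    ∃ λ x → x < b × X i a x × (∀ z → x < z → z ≤ b → st z at a is ● i)
  earlier {b = b} (b<N , new) a<b = origin b (<⇒≤ b<N) (move-raises (move _ b<N) new a<b)

  -- The horizontal line from (a , b) and the vertical line from (a′ , b′) meet unless one
  -- of them stops before.
  box-up : ∀ {i a a′ b b′} → X i a b → X i a′ b′ → a < a′ → b′ < b →
    ∃₂ λ p q → a < p × p ≤ a′ × b′ < q × q ≤ b × X (suc i) p q
  box-up {i} {a} {a′} {b} {b′} x x′ a<a′ b′<b with next x (<-trans a<a′ (≤-<-trans (X-≤ x′) b′<b))
  ... | p , a<p , xp , gap with p ≤? a′
  ... | yes p≤a′ = p , b , a<p , p≤a′ , b′<b , ≤-refl , xp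
  ... | no  p≰a′ with later x′ b b′<b (<⇒≤ (proj₁ x))
  ... | inj₁ h = ⊥-elim (gap a′ a<a′ (≰⇒> p≰a′) h)
  ... | inj₂ (q , b′<q , q<b , xq) = a′ , q , a<a′ , ≤-refl , b′<q , <⇒≤ q<b , xq

  -- Lines of the same level cannot cross.
  box-down : ∀ {i a a′ b b′} → X (suc i) a b → X (suc i) a′ b′ → a < a′ → b′ < b →
    ∃₂ λ p q → a ≤ p × p < a′ × b′ ≤ q × q < b × X i p q
  box-down {i} {a} {a′} {b} {b′} x x′ a<a′ b′<b with previous x′
  ... | p , p<a′ , xp , gap with a ≤? p
  ... | yes a≤p = p , b′ , a≤p , p<a′ , ≤-refl , b′<b , xp
  ... | no  a≰p with earlier x (<-trans a<a′ (≤-<-trans (X-≤ x′) b′<b))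
  ... | q , q<b , xq , h with b′ ≤? q
  ... | yes b′≤q = a , q , ≤-refl , a<a′ , b′≤q , q<b , xq
  ... | no  b′≰q = ⊥-elim (gap a (≰⇒> a≰p) a<a′ (h b′ (≰⇒> b′≰q) (<⇒≤ b′<b)))

  -- The weight is the length of the decreasing sequence formed by the nested points and
  -- their mirror images; an innermost point on the diagonal is its own mirror image.
  data Nest (i : ℕ) : ℕ → ℕ → ℕ → Set where
    nil  : ∀ {lo hi} → Nest i lo hi 0
    half : ∀ {lo hi a b} → lo ≤ a → b < hi → X i a b → Nest i lo hi 1
    cons : ∀ {lo hi a b t} → lo ≤ a → a < b → b < hi → X i a b → Nest i (suc a) b t →
           Nest i lo hi (suc (suc t))

  widen : ∀ {i lo lo′ hi hi′ t} → lo′ ≤ lo → hi ≤ hi′ → Nest i lo hi t → Nest i lo′ hi′ t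
  widen l h nil              = nil
  widen l h (half p q x)     = half (≤-trans l p) (≤-trans q h) x
  widen l h (cons p m q x r) = cons (≤-trans l p) m (≤-trans q h) x r

  -- Two consecutive points of a decreasing sequence enclose a shadow point between them. Inside the
  -- half diagram this is `box-up`; an innermost off-diagonal point and its mirror image yield the
  -- final `half`.
  nest-up : ∀ {i a b t} → X i a b → a < b → Nest i (suc a) b t → Nest (suc i) (suc a) (suc b) (suc t)
  nest-up x a<b nil with next x a<b
  ... | a′ , a<a′ , x′ , _ = half a<a′ ≤-refl x′
  nest-up x a<b (half a<a′ b′<b x′) with box-up x x′ a<a′ b′<b
  ... | p , q , a<p , p≤a′ , b′<q , q≤b , y =
    cons a<p (≤-<-trans (≤-trans p≤a′ (X-≤ x′)) b′<q) (s≤s q≤b) y nil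
  nest-up x a<b (cons a<a′ a′<b′ b′<b x′ r) with box-up x x′ a<a′ b′<b
  ... | p , q , a<p , p≤a′ , b′<q , q≤b , y =
    cons a<p (≤-<-trans (≤-trans p≤a′ (X-≤ x′)) b′<q) (s≤s q≤b) y
      (widen (s≤s p≤a′) b′<q (nest-up x′ a′<b′ r))

  nest-suc : ∀ {i lo hi t} → Nest i lo hi (suc t) → Nest (suc i) lo hi t
  nest-suc (half _ _ _)     = nil
  nest-suc (cons p m q x r) = widen (m≤n⇒m≤1+n p) q (nest-up x m r)

  nest-raise : ∀ m {i lo hi t} → Nest i lo hi (m + t) → Nest (m + i) lo hi t
  nest-raise zero        ν = ν
  nest-raise (suc m) {i} {lo} {hi} {t} ν = subst (λ j → Nest j lo hi t) (+-suc m i) (nest-raise m (nest-suc ν))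

  nest-down : ∀ {i a b t} → X (suc i) a b → a < b → Nest (suc i) (suc a) b t → Nest i a b (suc t)
  nest-down x a<b nil with earlier x a<b
  ... | y , y<b , x′ , _ = half ≤-refl y<b x′
  nest-down x a<b (half a<a′ b′<b x′) with box-down x x′ a<a′ b′<b
  ... | p , q , a≤p , p<a′ , b′≤q , q<b , y =
    cons a≤p (≤-trans p<a′ (≤-trans (X-≤ x′) b′≤q)) q<b y nil
  nest-down x a<b (cons a<a′ a′<b′ b′<b x′ r) with box-down x x′ a<a′ b′<b
  ... | p , q , a≤p , p<a′ , b′≤q , q<b , y =
    cons a≤p (≤-trans p<a′ (≤-trans (X-≤ x′) b′≤q)) q<b y (widen p<a′ b′≤q (nest-down x′ a′<b′ r))

  -- Besides the points between consecutive shadow points there is one outside: the source of the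
  -- outermost horizontal line. It lies further left, which is why the lower bound falls to 0.
  nest-pred : ∀ {i lo hi t} → Nest (suc i) lo hi (suc t) → Nest i 0 hi (suc (suc t))
  nest-pred (half p q x) with previous x
  ... | s , s<a , x′ , _ = cons z≤n (<-≤-trans s<a (X-≤ x)) q x′ nil
  nest-pred (cons p m q x r) with previous x
  ... | s , s<a , x′ , _ = cons z≤n (<-trans s<a m) q x′ (widen s<a ≤-refl (nest-down x m r))

  nest-lower : ∀ m {i hi t} → Nest (m + i) 0 hi (suc t) → Nest i 0 hi (m + suc t)
  nest-lower zero            ν = ν
  nest-lower (suc m) {t = t} ν = subst (Nest _ _ _) (+-suc m (suc t)) (nest-lower m (nest-pred ν))

  X₀-< : ∀ {a b} → X 0 a b → a < b
  X₀-< (b<N , new) = at-< (move-turns (move _ b<N) new)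

  -- No arc lies on the diagonal, so at level 0 a point counted as `half` always has a distinct
  -- mirror image.
  nest-round : ∀ k {lo hi} → Nest 0 lo hi (suc (dbl k)) → Nest 0 lo hi (dbl (suc k))
  nest-round zero    (half p q x)     = cons p (X₀-< x) q x nil
  nest-round (suc k) (cons p m q x r) = cons p m q x (nest-round k r)

  zero-before : ∀ {p d y} b → b ≤ y → y ≤ N → p < b → ZeroAt (st y) p d → ∃ λ q → q ≤ p × ZeroAt (st b) q d
  zero-before {y = y} b b≤y y≤N p<b z with b ≟ y
  ... | yes refl = _ , ≤-refl , z
  zero-before {y = zero} b b≤y y≤N p<b z | no ne = ⊥-elim (ne (n≤0⇒n≡0 b≤y))
  zero-before {y = suc y} b b≤y y<N p<b z | no ne
    with b≤y′ ← s≤s⁻¹ (≤∧≢⇒< b≤y ne)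
    with q , q≤p , z′ ← unmove-zero (move y y<N) (≤-trans p<b b≤y′) z
    with r , r≤q , z″ ← zero-before b b≤y′ (<⇒≤ y<N) (≤-<-trans q≤p p<b) z′
    = r , ≤-trans r≤q q≤p , z″

  -- Goes inwards, hence back in time. When an inner arc closes, its left end is `○ 0`, and
  -- `zero-before` finds to its left a `○ 0` with the count collected so far; the inner left end
  -- therefore counts one more.
  nest-zeros : ∀ k {lo hi p d} → Nest 0 lo hi (dbl k) → hi ≤ N → p < lo → ZeroAt (st hi) p d →
    ∃₂ λ y q → y ≤ N × ZeroAt (st y) q (k + d)
  nest-zeros zero    ν hi≤N p<lo z = _ , _ , hi≤N , z
  nest-zeros (suc k) {d = d} (cons lo≤a a<b b<hi x@(b<N , new) r) hi≤N p<lo z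
    with zero-before _ (<⇒≤ b<hi) hi≤N (≤-<-trans (≤-trans (<⇒≤ p<lo) lo≤a) a<b) z
  ... | q , q≤p , z′ =
    subst (λ e → ∃₂ λ y q → y ≤ N × ZeroAt (st y) q e) (+-suc k d)
      (nest-zeros k r (<⇒≤ b<N) ≤-refl
        (at-zero-suc (move-turns (move _ b<N) new) z′ (<-≤-trans (≤-<-trans q≤p p<lo) lo≤a)))

  nest-height : ∀ k {hi} → hi ≤ N → Nest 0 0 hi (dbl (suc k)) → ∃ λ y → y ≤ N × k < #○ (st y) 0
  nest-height k hi≤N (cons _ a<b b<hi x@(b<N , new) r)
    with nest-zeros k r (<⇒≤ b<N) ≤-refl (at-zero (move-turns (move _ b<N) new))
  ... | y , q , y≤N , z = y , y≤N , subst (_< _) (+-identityʳ k) (zero-count z)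

  -- Goes outwards, hence forward in time, with `f` steps left. Once the arc from `p` closes, an
  -- older `○ 0` is still open; it closes later and so encloses the arcs gathered in the nest.
  zeros-nest : #○ (st N) 0 ≡ 0 → ∀ f {y p d t} → f + y ≡ N → ZeroAt (st y) p d → Nest 0 (suc p) y t →
    Nest 0 0 N (dbl (suc d) + t)
  zeros-nest none zero    refl z ν = ⊥-elim (n≮0 (subst (_ <_) none (zero-count z)))
  zeros-nest none (suc f) {y} eq z ν with y<N ← subst (y <_) eq (s≤s (m≤n+m y f)) with move-zero (move y y<N) z
  ... | inj₁ z′ = zeros-nest none f (trans (+-suc f y) eq) z′ (widen ≤-refl (n≤1+n y) ν)
  zeros-nest none (suc f) {y} {d = zero} eq z ν | inj₂ (new , _) =
    cons z≤n (zero-< z) y<N (y<N , new) ν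
  zeros-nest none (suc f) {y} {p} {suc d} {t} eq z ν | inj₂ (new , older)
    with q , q<p , z′ ← older d refl =
    subst (Nest 0 0 N) (trans (+-suc (dbl (suc d)) (suc t)) (cong suc (+-suc (dbl (suc d)) t)))
      (zeros-nest none f (trans (+-suc f y) eq) z′
        (cons q<p (zero-< z) ≤-refl (y<N , new) ν))

  X-lower : ∀ m {i a b} → X (m + i) a b → ∃ λ a′ → X i a′ b
  X-lower zero    x = _ , x
  X-lower (suc m) x with _ , _ , x′ , _ ← previous x = X-lower m x′

  label-grows : ∀ {i a} f {y} → f + y ≡ N → st y at a is ● i → ∃ λ v → i ≤ v × st N at a is ● v
  label-grows zero    refl p = _ , ≤-refl , p
  label-grows (suc f) {y} eq p with move-shift (move y (subst (y <_) eq (s≤s (m≤n+m y f)))) p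
  ... | inj₁ p′ = label-grows f (trans (+-suc f y) eq) p′
  ... | inj₂ p′ with v , i<v , q ← label-grows f (trans (+-suc f y) eq) p′ = v , <⇒≤ i<v , q

  -- The k + 1 nested arcs weigh 2k + 2, so after 2k + 1 shadows a point remains; the label that it
  -- creates never decreases afterwards.
  tall⇒large : ∀ {k y} → #○ (st N) 0 ≡ 0 → y ≤ N → k < #○ (st y) 0 → ∃₂ λ a v → dbl k < v × st N at a is ● v
  tall⇒large {k} {y} none y≤N k< with p , z ← zero-exists (st y) k<
    with nest-raise (suc (dbl k)) (subst (Nest 0 0 N) (trans (+-identityʳ _) (cong suc (+-comm 1 (dbl k))))
           (zeros-nest none (N ∸ y) (m∸n+n≡m y≤N) z nil))
  ... | half {b = b} _ _ (b<N , p′ , _) with v , i≤v , q ← label-grows (N ∸ suc b) (m∸n+n≡m b<N) p′ =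
    _ , v , subst (λ j → suc j ≤ v) (+-identityʳ (dbl k)) i≤v , q

  -- A single point of level 2k gives weight 2k + 1 at level 0, which `nest-round` raises to that of
  -- k + 1 arcs.
  large⇒tall : ∀ {k a v} → dbl k ≤ v → st N at a is ● v → ∃ λ y → y ≤ N × k < #○ (st y) 0
  large⇒tall {k} {a} {v} k≤v p with x , x<N , xx , _ ← origin N ≤-refl p
    with a′ , x′ ← X-lower (v ∸ dbl k) (subst (λ j → X j a x) (sym (m∸n+n≡m k≤v)) xx) =
    nest-height k ≤-refl (nest-round k (subst (Nest 0 0 N) (+-comm (dbl k) 1)
      (nest-lower (dbl k) (half z≤n x<N (subst (λ j → X j a′ x) (sym (+-identityʳ (dbl k))) x′)))))

-- Heights of both tableaux

Low : ℕ → ∀ {n} → Vec Step n → Set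
Low k []      = ⊤
Low k (x ∷ s) = col (x ∷ s) 0 ≤ k × Low k s

low-col : ∀ {k n} (s : Vec Step n) → Low k s → col s 0 ≤ k
low-col []      _       = z≤n
low-col (x ∷ s) (h , _) = h

stage : ∀ {n} → Word n → (∀ y → Word y) → ∀ y → Word y
stage {n} w st y with y ≟ n
... | yes refl = w
... | no  _    = st y

state : ∀ {n} {s : Vec Step n} {w} → Run s w → ∀ y → Word y
-- Only the empty word at time 0 matters; the others are filler for the times after the end of the
-- run.
state []                    = λ y → replicate y (○ 0)
state {w = w} (add r)   = stage w (state r)
state {w = w} (del r _) = stage w (state r)

stage-top : ∀ {n} (w : Word n) st → stage w st n ≡ w
stage-top {n} w st with n ≟ n
... | yes refl = refl
... | no  ne   = ⊥-elim (ne refl)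

stage-below : ∀ {n} (w : Word n) st y → y ≢ n → stage w st y ≡ st y
stage-below {n} w st y y≢n with y ≟ n
... | yes y≡n = ⊥-elim (y≢n y≡n)
... | no  _   = refl

state-top : ∀ {n} {s : Vec Step n} {w} (r : Run s w) → state r n ≡ w
state-top []                = refl
state-top {w = w} (add r)   = stage-top w (state r)
state-top {w = w} (del r _) = stage-top w (state r)

stage-move : ∀ {n} {w : Word (suc n)} st → Move (st n) w → (∀ y → y < n → Move (st y) (st (suc y))) →
  ∀ y → y < suc n → Move (stage w st y) (stage w st (suc y))
stage-move {n} {w} st m f y y≤n rewrite stage-below w st y (λ e → <-irrefl e y≤n) with y ≟ n
... | yes refl = subst (Move _) (sym (stage-top w st)) m
... | no  y≢n  = subst (Move _) (sym (stage-below w st (suc y) (y≢n ∘ suc-injective)))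
                   (f y (≤∧≢⇒< (s≤s⁻¹ y≤n) y≢n))

state-move : ∀ {n} {s : Vec Step n} {w} (r : Run s w) → ∀ y → y < n → Move (state r y) (state r (suc y))
state-move (add r)    = stage-move (state r) (subst (λ v → Move v _) (sym (state-top r)) add) (state-move r)
state-move (del r sw) = stage-move (state r) (subst (λ v → Move v _) (sym (state-top r)) (del sw)) (state-move r)

low-stage : ∀ {k n} {w : Word (suc n)} {st} → #○ w 0 ≤ k → (∀ y → y ≤ n → #○ (st y) 0 ≤ k) →
  ∀ y → y ≤ suc n → #○ (stage w st y) 0 ≤ k
low-stage {n = n} h f y y≤n with y ≟ suc n
... | yes refl = h
... | no  ne   = f y (s≤s⁻¹ (≤∧≢⇒< y≤n ne))

low-state : ∀ {k n} {s : Vec Step n} {w} (r : Run s w) → Low k s → ∀ y → y ≤ n → #○ (state r y) 0 ≤ k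
low-state []            _       zero _ = z≤n
low-state r@(add q)     (h , l) = low-stage (≤-trans (≤-reflexive (run-col r 0)) h) (low-state q l)
low-state r@(del q sw)  (h , l) = low-stage (≤-trans (≤-reflexive (run-col r 0)) h) (low-state q l)

stage-low : ∀ {k n} {w : Word (suc n)} {st} → (∀ y → y ≤ suc n → #○ (stage w st y) 0 ≤ k) →
  #○ w 0 ≤ k × (∀ y → y ≤ n → #○ (st y) 0 ≤ k)
stage-low {k} {n} {w} {st} f =
  subst (λ v → #○ v 0 ≤ k) (stage-top w st) (f (suc n) ≤-refl) ,
  λ y y≤n → subst (λ v → #○ v 0 ≤ k) (stage-below w st y (λ e → <-irrefl e (s≤s y≤n))) (f y (m≤n⇒m≤1+n y≤n))

state-low : ∀ {k n} {s : Vec Step n} {w} (r : Run s w) → (∀ y → y ≤ n → #○ (state r y) 0 ≤ k) → Low k s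
state-low []           f = tt
state-low r@(add q)    f with h , g ← stage-low {st = state q} f = ≤-trans (≤-reflexive (sym (run-col r 0))) h , state-low q g
state-low r@(del q sw) f with h , g ← stage-low {st = state q} f = ≤-trans (≤-reflexive (sym (run-col r 0))) h , state-low q g

module _ {n k : ℕ} {s : Vec Step n} {w : Word n} (r : Run s w) (closed : #○ w 0 ≡ 0) where
  open History n (state r) (state-move r)

  private
    closed′ : #○ (state r n) 0 ≡ 0
    closed′ = trans (cong (λ v → #○ v 0) (state-top r)) closed

  low⇒small : Low k s → ∀ {a v} → w at a is ● v → v < dbl k
  low⇒small low {a} {v} p with v <? dbl k
  ... | yes v<  = v<
  ... | no  v≮ with y , y≤n , tall ← large⇒tall {k} (≮⇒≥ v≮) (subst (_at a is ● v) (sym (state-top r)) p) =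
    ⊥-elim (<⇒≱ tall (low-state r low y y≤n))

  small⇒low : (∀ {a v} → w at a is ● v → v < dbl k) → Low k s
  small⇒low small = state-low r bound
    where
    bound : ∀ y → y ≤ n → #○ (state r y) 0 ≤ k
    bound y y≤n with #○ (state r y) 0 ≤? k
    ... | yes le = le
    ... | no  gt with a , v , k<v , p ← tall⇒large {k} closed′ y≤n (≰⇒> gt) =
      ⊥-elim (<-asym k<v (small (subst (_at a is ● v) (state-top r) p)))

-- Closing the open arcs

-- Column heights of a one-row shape.
below : ℕ → ℕ → ℕ
below zero    c       = 0
below (suc m) zero    = 1
below (suc m) (suc c) = below m c

Row : ∀ {n} → ℕ → Vec Step n → Set
Row m s = ∀ c → col s c ≡ below m c

below-suc : ∀ i c → below (suc i) c ≡ δ c i + below i c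
below-suc zero    zero    = refl
below-suc zero    (suc c) = refl
below-suc (suc i) zero    = refl
below-suc (suc i) (suc c) = below-suc i c

below-top : ∀ i → below i i ≡ 0
below-top zero    = refl
below-top (suc i) = below-top i

below-≥ : ∀ i {c} → i ≤ c → below i c ≡ 0
below-≥ zero    _         = refl
below-≥ (suc i) (s≤s i≤c) = below-≥ i i≤c

below-injective : ∀ m m′ → (∀ c → below m c ≡ below m′ c) → m ≡ m′
below-injective zero    zero     eq = refl
below-injective zero    (suc m′) eq with () ← eq 0
below-injective (suc m) zero     eq with () ← eq 0
below-injective (suc m) (suc m′) eq = cong suc (below-injective m m′ (eq ∘ suc))

-- The newest step comes first, so a row of `m + i` boxes is shortened from its right end and keeps
-- `i` boxes.
clear : ∀ {n} i m → Vec Step n → Vec Step (m + n)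
clear i zero    s = s
clear i (suc m) s = del i ∷ clear (suc i) m s

clear-injective : ∀ {n} i m {s s′ : Vec Step n} → clear i m s ≡ clear i m s′ → s ≡ s′
clear-injective i zero    eq = eq
clear-injective i (suc m) eq = clear-injective (suc i) m (proj₂ (∷-injective eq))

clear-row : ∀ {n} i m {s : Vec Step n} → Row (m + i) s → Row i (clear i m s)
clear-row i zero    row c = row c
clear-row i (suc m) {s} row c rewrite clear-row (suc i) m {s} (λ c → trans (row c) (cong (λ z → below z c) (sym (+-suc m i)))) c =
  trans (cong (_∸ δ c i) (below-suc i c)) (m+n∸m≡n (δ c i) (below i c))

clear-osc : ∀ {n} i m {s : Vec Step n} → Row (m + i) s → Osc s → Osc (clear i m s)
clear-osc i zero    row o = o
clear-osc i (suc m) {s} row o = rem , clear-osc (suc i) m row′ o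
  where
  row′ : Row (m + suc i) s
  row′ c = trans (row c) (cong (λ z → below z c) (sym (+-suc m i)))
  cl : Row (suc i) (clear (suc i) m s)
  cl = clear-row (suc i) m row′
  rem : Removable (col (clear (suc i) m s)) i
  rem = subst₂ _<_ (sym (trans (cl (suc i)) (below-top i)))
    (sym (trans (cl i) (trans (below-suc i i) (cong (_+ below i i) (δ-refl i))))) (s≤s z≤n)

clear-low : ∀ {k n} i m {s : Vec Step n} → Low k s → Low k (clear i m s)
clear-low i zero    l = l
clear-low i (suc m) {s} l with l′ ← clear-low (suc i) m l =
  ≤-trans (m∸n≤m _ (δ 0 i)) (low-col (clear (suc i) m s) l′) , l′

low-clear : ∀ {k n} i m {s : Vec Step n} → Low k (clear i m s) → Low k s
low-clear i zero    l = l
low-clear i (suc m) l = low-clear (suc i) m (proj₂ l)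

osc-desc : ∀ {n} (s : Vec Step n) → Osc s → Desc (col s)
osc-desc s o with w , r , g ← osc-run s o = desc-≗ (run-col r) (yam-desc #○ w (yam○ g))

-- Row clearing and ascending tails.

Ascending : ∀ {m} → Vec ℕ m → Set
Ascending []      = ⊤
Ascending (x ∷ t) = All (x ≤_) t × Ascending t

sweep-past : ∀ {m n c j v} (t : Vec ℕ m) {w : Word n} → All (j <_) t → Sweep c (map ● t ++ w) v j →
  ∃ λ w′ → v ≡ map ● t ++ w′
sweep-past []      _        s            = _ , refl
sweep-past (y ∷ t) (lt ∷ _) (●-hit s)    = ⊥-elim (<-asym lt ≤-refl)
sweep-past (y ∷ t) (_ ∷ gt) (●-pass _ s) with w′ , refl ← sweep-past t gt s = w′ , refl

unsweep-past : ∀ {m n c j v} (t : Vec ℕ m) {w′ : Word n} → All (j <_) t → Sweep c v (map ● t ++ w′) j →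
  ∃ λ w → v ≡ map ● t ++ w
unsweep-past []      _        s            = _ , refl
unsweep-past (_ ∷ t) (lt ∷ _) turn         = ⊥-elim (<-irrefl refl lt)
unsweep-past (_ ∷ t) (lt ∷ _) (●-hit s)    = ⊥-elim (<-irrefl refl lt)
unsweep-past (y ∷ t) (_ ∷ gt) (●-pass _ s) with w , refl ← unsweep-past t gt s = w , refl

-- The last component is the invariant: by the bumping lemma a later deletion further left ends in a
-- row above all letters of `t`, and hence passes over them without change.
clear-run : ∀ {n} i m {s : Vec Step n} {v} → Run (clear i m s) v →
  ∃₂ λ (t : Vec ℕ m) w → v ≡ map ● t ++ w × Ascending t ×
    (∀ {c v′ j} → c < i → Sweep c v v′ j → All (j <_) t × ∃ λ w′ → v′ ≡ map ● t ++ w′)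
clear-run i zero    r = [] , _ , refl , tt , λ _ _ → [] , _ , refl
clear-run i (suc m) (del {j = j} r s) with clear-run (suc i) m r
... | t , w , refl , asc , f with f ≤-refl s
... | gt , w′ , refl = suc j ∷ t , w′ , refl , (gt , asc) , g
  where
  g : ∀ {c v′ j′} → c < i → Sweep c (map ● (suc j ∷ t) ++ w′) v′ j′ →
    All (j′ <_) (suc j ∷ t) × ∃ λ w″ → v′ ≡ map ● (suc j ∷ t) ++ w″
  -- A hit would require `q` to arrive in row `suc j`, beyond the row `j` allowed by the bumping
  -- lemma.
  g c<i (●-hit q)    = ⊥-elim (<-irrefl refl (proj₁ (two-sweeps s q) c<i))
  g c<i (●-pass _ q) with j′≤j ← proj₁ (two-sweeps s q) c<i
                     with gt′ ← All.map (≤-trans (s≤s j′≤j)) gt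
                     with w″ , refl ← sweep-past t gt′ q = s≤s j′≤j ∷ gt′ , w″ , refl

del-counts : ∀ {n i c} {s : Vec Step n} → Removable (col s) c → Row i (del c ∷ s) →
  ∀ x → col s x ≡ δ x c + below i x
del-counts {i = i} {c} {s} rm row x with x ≟ c
... | yes refl = trans (sym (m+[n∸m]≡n (subst (_≤ col s x) (sym (δ-refl x)) (≤-trans (s≤s z≤n) rm))))
                   (cong (δ x x +_) (row x))
... | no  x≢c  = trans (cong (col s x ∸_) (sym (δ-≢ x≢c))) (trans (row x) (cong (_+ below i x) (sym (δ-≢ x≢c))))

-- Otherwise, before the deletion, column `c` would hold a box while the column to its left is
-- empty.
del-≤ : ∀ {n i c} {s : Vec Step n} → Osc (del c ∷ s) → Row i (del c ∷ s) → c ≤ i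
del-≤ {c = zero} _ _ = z≤n
del-≤ {i = i} {suc d} {s} (rm , o) row with suc d ≤? i
... | yes d<i = d<i
... | no  d≮i = ⊥-elim (<-irrefl refl (subst₂ _≤_ one none (osc-desc s o d)))
  where
  one : col s (suc d) ≡ 1
  one = trans (del-counts {i = i} {s = s} rm row (suc d)) (cong₂ _+_ (δ-refl d) (below-≥ i (m≤n⇒m≤1+n (≮⇒≥ d≮i))))
  none : col s d ≡ 0
  none = trans (del-counts {i = i} {s = s} rm row d) (cong₂ _+_ (δ-≢ {d} {suc d} (λ e → 1+n≢n (sym e))) (below-≥ i (≮⇒≥ d≮i)))

-- `link` is the deletion made just afterwards, in column `d`. Were `c` at most `d`, the bumping
-- lemma would send that sweep strictly below row `j`.
del-≥ : ∀ {n i c j} {w w′ : Word n} → Sweep c w w′ j →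
  (∀ d → i ≡ suc d → ∃₂ λ v k → Sweep d (● (suc j) ∷ w′) v k × k ≤ j) → i ≤ c
del-≥ {i = zero}  s link = z≤n
del-≥ {i = suc d} {c} s link with suc d ≤? c
... | yes d<c = d<c
... | no  d≮c with link d refl
... | _ , _ , ●-hit q    , le = ⊥-elim (<⇒≱ le (n≤1+n _))
... | _ , _ , ●-pass _ q , le = ⊥-elim (<⇒≱ (proj₂ (two-sweeps s q) (≮⇒≥ d≮c)) le)

-- Going back in time, each deleted column is forced: at most `i` by the shape, at least `i` by the
-- deletion that follows. For the very last deletion `i` is 0 and `link` is vacuous.
run-clear : ∀ {m n} i (t : Vec ℕ m) {w : Word n} {s} → Run s (map ● t ++ w) → Ascending t → Osc s → Row i s →
  (∀ d → i ≡ suc d → ∃₂ λ v j → Sweep d (map ● t ++ w) v j × All (j <_) t) →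
  ∃ λ s′ → s ≡ clear i m s′ × Row (m + i) s′ × Osc s′
run-clear i []      {s = s} r _ o row link = s , refl , row , o
run-clear {suc m} i (_ ∷ t) {w} (del {c = c} {j = j} {s = s} r sw) (gt , asc) o row link
  with w₁ , refl ← unsweep-past t gt sw
  with refl ← ≤-antisym (del-≤ o row) (del-≥ sw (λ d eq → let v , k , q , g = link d eq in v , k , q , s≤s⁻¹ (All.head g)))
  with s′ , refl , row′ , o′ ← run-clear (suc i) t {w₁} r asc (proj₂ o)
         (λ x → trans (del-counts {i = i} {s = s} (proj₁ o) row x) (sym (below-suc i x))) (λ { _ refl → _ , j , sw , gt }) =
    s′ , refl , (λ x → trans (row′ x) (cong (λ z → below z x) (+-suc m i))) , o′

-- Completion to even columns by a horizontal strip.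

occ : ∀ {m} → Vec ℕ m → ℕ → ℕ
occ t = #● (map ● t)

#●-++ : ∀ {m n} (t : Vec ℕ m) (w : Word n) i → #● (map ● t ++ w) i ≡ occ t i + #● w i
#●-++ []      w i = refl
#●-++ (x ∷ t) w i = trans (cong (δ i x +_) (#●-++ t w i)) (sym (+-assoc (δ i x) (occ t i) (#● w i)))

occ-≢ : ∀ {m} (t : Vec ℕ m) {i} → All (_≢ i) t → occ t i ≡ 0
occ-≢ []      []       = refl
occ-≢ (x ∷ t) (p ∷ ps) = cong₂ _+_ (δ-≢ (p ∘ sym)) (occ-≢ t ps)

occ-head : ∀ {m} x (t : Vec ℕ m) → 0 < occ (x ∷ t) x
occ-head x t rewrite δ-refl x = s≤s z≤n

ascending-occ : ∀ {m x y} (t : Vec ℕ m) → x < y → Ascending (y ∷ t) → occ (y ∷ t) x ≡ 0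
ascending-occ {x = x} {y} t x<y (ge , _) =
  occ-≢ (y ∷ t) ((λ e → <-irrefl (sym e) x<y) ∷ All.map (λ y≤z e → <-irrefl (sym e) (<-≤-trans x<y y≤z)) ge)

ascending-unique : ∀ {m m′} (t : Vec ℕ m) (t′ : Vec ℕ m′) → Ascending t → Ascending t′ →
  (∀ i → occ t i ≡ occ t′ i) → _≡_ {A = ∃ (Vec ℕ)} (m , t) (m′ , t′)
ascending-unique []      []       _ _ eq = refl
ascending-unique []      (y ∷ t′) _ _ eq = ⊥-elim (<-irrefl (eq y) (occ-head y t′))
ascending-unique (x ∷ t) []       _ _ eq = ⊥-elim (<-irrefl (sym (eq x)) (occ-head x t))
ascending-unique (x ∷ t) (y ∷ t′) a a′ eq with <-cmp x y
... | tri< x<y _ _ = ⊥-elim (<-irrefl (sym (trans (eq x) (ascending-occ t′ x<y a′))) (occ-head x t))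
... | tri> _ _ y<x = ⊥-elim (<-irrefl (sym (trans (sym (eq y)) (ascending-occ t y<x a))) (occ-head y t′))
... | tri≈ _ refl _
  with refl ← ascending-unique t t′ (proj₂ a) (proj₂ a′) (λ i → +-cancelˡ-≡ (δ i x) _ _ (eq i)) = refl

-- The letters of an ascending tail form a horizontal strip.
horizontal : ∀ {m n} (t : Vec ℕ m) (w : Word n) → Ascending t → Yam #● (map ● t ++ w) →
  ∀ r → #● (map ● t ++ w) (suc r) ≤ #● w r
horizontal []      w a y r = yam-desc #● w y r
horizontal (x ∷ t) w a@(ge , asc) (d , y) r with r <? x
... | yes r<x = ≤-trans (d r) (≤-reflexive (trans (#●-++ (x ∷ t) w r) (cong (_+ #● w r) (ascending-occ t r<x a))))
... | no  r≮x = ≤-trans (≤-reflexive (cong (_+ #● (map ● t ++ w) (suc r)) (δ-≢ (λ e → r≮x (≤-reflexive e)))))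
                        (horizontal t w asc y r)

-- A completed even row has the length of the row below it, which interlacing keeps within the old
-- length of the even row. So the strip lies in odd rows, and uniqueness follows.
paired-even : ∀ {m n} (t : Vec ℕ m) (w : Word n) → Ascending t → Yam #● (map ● t ++ w) →
  Paired (#● (map ● t ++ w)) → ∀ i → #● (map ● t ++ w) (dbl i) ≡ #● w (dbl i)
paired-even t w a y p i = ≤-antisym
  (≤-trans (≤-reflexive (p i)) (horizontal t w a y (dbl i)))
  (≤-trans (m≤n+m _ (occ t (dbl i))) (≤-reflexive (sym (#●-++ t w (dbl i)))))

tail-unique : ∀ {m m′ n} (t : Vec ℕ m) (t′ : Vec ℕ m′) (w : Word n) → Ascending t → Ascending t′ →
  Yam #● (map ● t ++ w) → Yam #● (map ● t′ ++ w) →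
  Paired (#● (map ● t ++ w)) → Paired (#● (map ● t′ ++ w)) → _≡_ {A = ∃ (Vec ℕ)} (m , t) (m′ , t′)
tail-unique t t′ w a a′ y y′ p p′ = ascending-unique t t′ a a′
  λ i → +-cancelʳ-≡ (#● w i) _ _ (trans (sym (#●-++ t w i)) (trans (same i) (#●-++ t′ w i)))
  where
  same-even : ∀ i → #● (map ● t ++ w) (dbl i) ≡ #● (map ● t′ ++ w) (dbl i)
  same-even i = trans (paired-even t w a y p i) (sym (paired-even t′ w a′ y′ p′ i))
  same : ∀ i → #● (map ● t ++ w) i ≡ #● (map ● t′ ++ w) i
  same i with parity? i
  ... | even j = same-even j
  ... | odd  j = trans (sym (p j)) (trans (same-even j) (p′ j))

record Tail {n} (w : Word n) (K lo : ℕ) (P : (ℕ → ℕ) → Set) : Set where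
  field
    {size}  : ℕ
    letters : Vec ℕ size
    asc     : Ascending letters
    bounded : All (λ x → lo ≤ x × x < K) letters
    yam     : Yam #● (map ● letters ++ w)
    filled  : P (#● (map ● letters ++ w))

-- `d` is what row `suc x` lacks to the length of row `x`; `resp` states that `P` does not look at
-- row `suc x`.
fill : ∀ {n K P x} {w : Word n} d (t : Tail w K x P) → suc x < K →
  (∀ {f g} → (∀ i → i ≢ suc x → g i ≡ f i) → P f → P g) →
  (let f = #● (map ● (Tail.letters t) ++ w)) → All (suc x ≤_) (Tail.letters t) → d + f (suc x) ≡ f x →
  Tail w K (suc x) (λ f → P f × f x ≡ f (suc x))
fill zero t x<K resp ge eq = record
  { letters = letters ; asc = asc
  ; bounded = All.map (λ { (p , _ , r) → p , r }) (All.zip (ge , bounded))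
  ; yam = yam ; filled = filled , sym eq }
  where open Tail t
fill {K = K} {x = x} {w} (suc d) t x<K resp ge eq = fill d record
  { letters = suc x ∷ letters ; asc = ge , asc
  ; bounded = (n≤1+n x , x<K) ∷ bounded
  ; yam = desc-add (yam-desc #● (map ● letters ++ w) yam) (λ { _ refl → ≤-trans (s≤s (m≤n+m (f (suc x)) d)) (≤-reflexive eq) }) (λ _ → refl) , yam
  ; filled = resp (λ i i≢ → cong (_+ f i) (δ-≢ i≢)) filled }
  x<K resp (≤-refl ∷ ge)
  (trans (cong (λ z → d + (z + f (suc x))) (δ-refl x)) (trans (+-suc d (f (suc x))) (trans eq
    (sym (cong (_+ f x) (δ-≢ {x} {suc x} (λ e → 1+n≢n (sym e))))))))
  where
  open Tail t
  f = #● (map ● letters ++ w)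

Paired≥ : ℕ → (ℕ → ℕ) → Set
Paired≥ i f = ∀ j → i ≤ j → f (dbl j) ≡ f (suc (dbl j))

dbl-mono : ∀ {i j} → i ≤ j → dbl i ≤ dbl j
dbl-mono z≤n       = z≤n
dbl-mono (s≤s i≤j) = s≤s (s≤s (dbl-mono i≤j))

dbl-injective : ∀ {i j} → dbl i ≡ dbl j → i ≡ j
dbl-injective {zero}  {zero}  eq = refl
dbl-injective {suc i} {suc j} eq = cong suc (dbl-injective (suc-injective (suc-injective eq)))

tail-weaken : ∀ {n K lo lo′ P Q} {w : Word n} → lo′ ≤ lo → (∀ {f} → P f → Q f) → Tail w K lo P → Tail w K lo′ Q
tail-weaken l h t = record
  { letters = letters ; asc = asc ; yam = yam ; filled = h filled
  ; bounded = All.map (λ { (p , q) → ≤-trans l p , q }) bounded }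
  where open Tail t

-- Pairs of rows are filled from the bottom upwards, because newer letters of an ascending tail lie
-- in smaller rows; `d` counts the pairs that are done.
tail-exists : ∀ {n k} (u : Vec ℕ n) → Yam #● (map ● u) → All (_< dbl k) u →
  ∀ d i → d + i ≡ k → Tail (map ● u) (dbl k) (dbl i) (Paired≥ i)
tail-exists u y small zero i refl = record
  { letters = [] ; asc = tt ; bounded = [] ; yam = y
  ; filled = λ j i≤j → trans (none (dbl j) (dbl-mono i≤j)) (sym (none (suc (dbl j)) (m≤n⇒m≤1+n (dbl-mono i≤j)))) }
  where
  none : ∀ r → dbl i ≤ r → occ u r ≡ 0
  none r le = occ-≢ u (All.map (λ x< e → <⇒≱ x< (≤-trans le (≤-reflexive (sym e)))) small)
tail-exists {k = k} u y small (suc d) i eq =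
  tail-weaken (n≤1+n (dbl i)) (λ { {g} (p , q) → pair {g} p q })
    (fill {P = Paired≥ (suc i)} (f (dbl i) ∸ f (suc (dbl i)))
      (tail-weaken {P = Paired≥ (suc i)} (≤-trans (n≤1+n _) (n≤1+n _)) (λ p → p) t)
      (dbl-mono (subst (suc i ≤_) eq (s≤s (m≤n+m i d))))
      (λ same p j i<j → trans (same (dbl j) (dbl-≢ j i))
        (trans (p j i<j) (sym (same (suc (dbl j)) (λ e → <-irrefl (sym (dbl-injective (suc-injective e))) i<j)))))
      (All.map (λ { (p , _) → ≤-trans (n≤1+n _) p }) bounded)
      (m∸n+n≡m (yam-desc #● (map ● letters ++ map ● u) yam (dbl i))))
  where
  t = tail-exists u y small d (suc i) (trans (+-suc d i) eq)
  open Tail t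
  f = #● (map ● letters ++ map ● u)
  pair : ∀ {f} → Paired≥ (suc i) f → f (dbl i) ≡ f (suc (dbl i)) → Paired≥ i f
  pair p q j i≤j with i ≟ j
  ... | yes refl = q
  ... | no  i≢j  = p j (≤∧≢⇒< i≤j i≢j)

yam-drop : ∀ (# : ∀ {n} → Word n → ℕ → ℕ) {m n} (t : Word m) (w : Word n) → Yam # (t ++ w) → Yam # w
yam-drop # []      w y = y
yam-drop # (_ ∷ t) w y = yam-drop # t w (proj₂ y)

#○-● : ∀ {n} (u : Vec ℕ n) i → #○ (map ● u) i ≡ 0
#○-● []      i = refl
#○-● (_ ∷ u) i = #○-● u i

#○-++ : ∀ {m n} (t : Vec ℕ m) (w : Word n) i → #○ (map ● t ++ w) i ≡ #○ w i
#○-++ []      w i = refl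
#○-++ (_ ∷ t) w i = #○-++ t w i

yam○-● : ∀ {m n} (t : Vec ℕ m) (u : Vec ℕ n) → Yam #○ (map ● t ++ map ● u)
yam○-● []      []      = λ _ → z≤n
yam○-● []      (x ∷ u) = (λ i → ≤-reflexive (trans (#○-● u (suc i)) (sym (#○-● u i)))) , yam○-● [] u
yam○-● (_ ∷ t) u       = (λ i → ≤-reflexive (trans (none (suc i)) (sym (none i)))) , yam○-● t u
  where none = λ i → trans (#○-++ t (map ● u) i) (#○-● u i)

closed-word : ∀ {n} (w : Word n) → (∀ i → #○ w i ≡ 0) → ∃ λ u → w ≡ map ● u
closed-word []        none = [] , refl
closed-word (○ x ∷ w) none with () ← trans (sym (none x)) (cong (_+ #○ w x) (δ-refl x))
closed-word (● y ∷ w) none with u , refl ← closed-word w none = y ∷ u , refl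

all-at : ∀ {n} {P : ℕ → Set} (u : Vec ℕ n) → (∀ {a v} → map ● u at a is ● v → P v) → All P u
all-at []      f = []
all-at (x ∷ u) f = f here ∷ all-at u (f ∘ there)

at-all : ∀ {n a v} {P : ℕ → Set} (u : Vec ℕ n) → All P u → map ● u at a is ● v → P v
at-all (x ∷ u) (p ∷ ps) here      = p
at-all (x ∷ u) (p ∷ ps) (there q) = at-all u ps q

at-++ : ∀ {m n a l} (t : Word m) {w : Word n} → w at a is l → (t ++ w) at a is l
at-++ []      p = p
at-++ (_ ∷ t) p = there (at-++ t p)

++-at : ∀ {m n a v} {P : ℕ → Set} (t : Vec ℕ m) (u : Vec ℕ n) → All P t → All P u →
  (map ● t ++ map ● u) at a is ● v → P v
++-at []      u _        ps q         = at-all u ps q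
++-at (x ∷ t) u (p ∷ _)  _  here      = p
++-at (x ∷ t) u (_ ∷ pt) ps (there q) = ++-at t u pt ps q

map-injective : ∀ {A B : Set} {h : A → B} → (∀ {x y} → h x ≡ h y → x ≡ y) →
  ∀ {n} {u v : Vec A n} → map h u ≡ map h v → u ≡ v
map-injective inj {u = []}    {[]}    eq = refl
map-injective inj {u = x ∷ u} {y ∷ v} eq with a , b ← ∷-injective eq = cong₂ _∷_ (inj a) (map-injective inj b)

-- A bijection between the subsets P and Q, given by its graph R.
record BijRel {A B : Set} (P : A → Set) (Q : B → Set) (R : A → B → Set) : Set where
  field
    to         : ∀ {a} → P a → ∃ λ b → Q b × R a b
    from       : ∀ {b} → Q b → ∃ λ a → P a × R a b
    functional : ∀ {a b b′} → P a → Q b → Q b′ → R a b → R a b′ → b ≡ b′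
    injective  : ∀ {a a′ b} → P a → P a′ → Q b → R a b → R a′ b → a ≡ a′

-- From oscillating tableaux to standard tableaux.

OscRow : ℕ → ∀ {n} → Vec Step n → Set
OscRow k s = Osc s × Low k s × ∃ λ m → Row m s

SYT : ℕ → ∀ {n} → Vec ℕ n → Set
SYT k u = Yam #● (map ● u) × All (_< dbl k) u

-- `u` is not the word reached at the end of `s`: it is what those letters have become after the `m`
-- closing deletions, whose own letters are `t`.
Corresponds : ∀ {n} → Vec Step n → Vec ℕ n → Set
Corresponds s u = ∃₂ λ m (t : Vec ℕ m) → Row m s × Ascending t × Run (clear 0 m s) (map ● t ++ map ● u)

row-0 : ∀ {n} m (s : Vec Step n) → Row m s → Row (m + 0) s
row-0 m s row c = trans (row c) (cong (λ z → below z c) (sym (+-identityʳ m)))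

corresponds-good : ∀ {n m} {s : Vec Step n} {w} → Osc s → Row m s → Run (clear 0 m s) w → Good w
corresponds-good {m = m} {s} o row r with w , r′ , g ← osc-run (clear 0 m s) (clear-osc 0 m (row-0 m s row) o)
  = subst Good (run-functional r′ r) g

corresponds : ∀ {k n} → BijRel (OscRow k {n}) (SYT k {n}) Corresponds
corresponds {k} {n} = record { to = to ; from = from ; functional = functional ; injective = injective }
  where
  to : ∀ {s : Vec Step n} → OscRow k s → ∃ λ u → SYT k u × Corresponds s u
  to {s} (o , low , m , row)
    with w , r , g ← osc-run (clear 0 m s) (clear-osc 0 m (row-0 m s row) o)
    with t , v , refl , asc , _ ← clear-run 0 m {s} r
    with none ← (λ i → trans (run-col r i) (clear-row 0 m {s} (row-0 m s row) i))
    with u , refl ← closed-word v (λ i → trans (sym (#○-++ t v i)) (none i)) =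
    u , (yam-drop #● (map ● t) (map ● u) (yam● g)
        , all-at u (λ p → low⇒small r (none 0) (clear-low 0 m low) (at-++ (map ● t) p)))
      , m , t , row , asc , r

  from : ∀ {u : Vec ℕ n} → SYT k u → ∃ λ s → OscRow k s × Corresponds s u
  from {u} (y , small)
    with T ← tail-exists u y small k 0 (+-identityʳ k)
    with m ← Tail.size T | t ← Tail.letters T | asc ← Tail.asc T | bd ← Tail.bounded T | yam ← Tail.yam T | p ← Tail.filled T
    with S , r , o ← good-run (map ● t ++ map ● u) (good (yam○-● t u) yam (λ i → p i z≤n))
    with none ← (λ i → trans (#○-++ t (map ● u) i) (#○-● u i))
    with s , refl , row , o′ ← run-clear 0 t {map ● u} r asc o (λ c → trans (sym (run-col r c)) (none c)) (λ _ ()) =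
    s , (o′ , low-clear 0 m (small⇒low r (none 0) (++-at t u (All.map proj₂ bd) small)) , m , row0 m s row)
      , m , t , row0 m s row , asc , r
    where
    row0 : ∀ m (s : Vec Step n) → Row (m + 0) s → Row m s
    row0 m s row c = trans (row c) (cong (λ z → below z c) (+-identityʳ m))

  functional : ∀ {s : Vec Step n} {u u′} → OscRow k s → SYT k u → SYT k u′ → Corresponds s u → Corresponds s u′ → u ≡ u′
  functional _ _ _ (m , t , row , _ , r) (m′ , t′ , row′ , _ , r′)
    with refl ← below-injective m m′ (λ c → trans (sym (row c)) (row′ c)) =
    map-injective (λ { refl → refl }) (proj₂ (++-injective (map ● t) (map ● t′) (run-functional r r′)))

  injective : ∀ {s s′ : Vec Step n} {u} → OscRow k s → OscRow k s′ → SYT k u → Corresponds s u → Corresponds s′ u → s ≡ s′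
  injective {s} {s′} {u} (o , _) (o′ , _) _ (m , t , row , a , r) (m′ , t′ , row′ , a′ , r′)
    with good _ y p ← corresponds-good {m = m} {s} o row r | good _ y′ p′ ← corresponds-good {m = m′} {s′} o′ row′ r′
    -- Both tails complete the same `u` to even columns, so the two runs end in the same word.
    with refl ← tail-unique t t′ (map ● u) a a′ y y′ p p′ = clear-injective 0 m (run-injective r r′)

-- Transposition

record Conj (f g : ℕ → ℕ) : Set where
  constructor conj
  field
    into : ∀ {r c} → r < g c → c < f r
    back : ∀ {r c} → c < f r → r < g c

open Conj

conj-sym : ∀ {f g} → Conj f g → Conj g f
conj-sym (conj i b) = conj b i

conj-unique : ∀ {f f′ g} → Conj f g → Conj f′ g → ∀ r → f r ≡ f′ r
conj-unique a b r = ≤-antisym (le a b) (le b a)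
  where
  le : ∀ {f f′ g} → Conj f g → Conj f′ g → f r ≤ f′ r
  le {f} {f′} a b = ≮⇒≥ λ lt → <-irrefl refl (into b (back a lt))

module _ {f g : ℕ → ℕ} (p : Conj f g) where

  conj-addable : ∀ {r} → Addable f r → g (f r) ≡ r × Addable g (f r)
  conj-addable {r} ad = corner , λ i eq → ≤-trans (≤-reflexive (cong suc corner)) (back p (≤-reflexive (sym eq)))
    where
    lower : ∀ s → s ≡ r → s ≤ g (f r)
    lower zero    _    = z≤n
    lower (suc s) refl = back p (ad s refl)
    corner : g (f r) ≡ r
    corner = ≤-antisym (≮⇒≥ (<-irrefl refl ∘ into p)) (lower r refl)

  conj-removable : ∀ {r} → Removable f r → ∃ λ c → f r ≡ suc c × g c ≡ suc r × Removable g c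
  conj-removable {r} rm = go (f r) refl
    where
    go : ∀ m → f r ≡ m → ∃ λ c → f r ≡ suc c × g c ≡ suc r × Removable g c
    go zero    eq = ⊥-elim (n≮0 (subst (f (suc r) <_) eq rm))
    go (suc c) eq = c , eq , height ,
      ≤-trans (s≤s (≮⇒≥ (λ lt → <-irrefl (sym eq) (into p lt)))) (≤-reflexive (sym height))
      where
      height : g c ≡ suc r
      height = ≤-antisym (≮⇒≥ (λ lt → <⇒≱ (into p lt) (s≤s⁻¹ (≤-trans rm (≤-reflexive eq)))))
                         (back p (≤-reflexive (sym eq)))

conj-add : ∀ {f g r c} → Conj f g → f r ≡ c → g c ≡ r →
  Conj (λ x → δ x r + f x) (λ y → δ y c + g y)
conj-add {f} {g} {r} {c} p fr gc = conj (half p fr gc) (half (conj-sym p) gc fr)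
  where
  half : ∀ {f g r c} → Conj f g → f r ≡ c → g c ≡ r → ∀ {x y} → x < δ y c + g y → y < δ x r + f x
  half {r = r} {c} p fr gc {x} {y} lt with x ≟ r | y ≟ c
  ... | yes refl | yes refl rewrite δ-refl x = ≤-reflexive (cong suc (sym fr))
  ... | yes refl | no  ne   rewrite δ-refl x | δ-≢ ne = m≤n⇒m≤1+n (into p lt)
  ... | no  ne   | yes refl rewrite δ-refl y | δ-≢ ne =
    into p (≤-trans (≤∧≢⇒< (s≤s⁻¹ lt) (λ e → ne (trans e gc))) ≤-refl)
  ... | no  ne   | no  ne′  rewrite δ-≢ ne | δ-≢ ne′ = into p lt

conj-del : ∀ {f g r c} → Conj f g → f r ≡ suc c → g c ≡ suc r →
  Conj (λ x → f x ∸ δ x r) (λ y → g y ∸ δ y c)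
conj-del {f} {g} {r} {c} p fr gc = conj (half p fr gc) (half (conj-sym p) gc fr)
  where
  half : ∀ {f g r c} → Conj f g → f r ≡ suc c → g c ≡ suc r → ∀ {x y} → x < g y ∸ δ y c → y < f x ∸ δ x r
  half {r = r} {c} p fr gc {x} {y} lt with x ≟ r | y ≟ c
  ... | yes refl | yes refl rewrite δ-refl y | gc = ⊥-elim (<-irrefl refl lt)
  ... | yes refl | no  ne   rewrite δ-refl x | δ-≢ ne | fr = ≤∧≢⇒< (s≤s⁻¹ (subst (y <_) fr (into p lt))) ne
  ... | no  ne   | yes refl rewrite δ-refl y | δ-≢ ne = into p (<-≤-trans lt (m∸n≤m _ 1))
  ... | no  ne   | no  ne′  rewrite δ-≢ ne | δ-≢ ne′ = into p lt

-- Corresponding steps name one box, by its row `r` and by its column `c`; so `col s` gives row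
-- lengths here and `col t` column lengths.
data Transpose : ∀ {n} → Vec Step n → Vec Step n → Set where
  []  : Transpose [] []
  add : ∀ {n r c} {s t : Vec Step n} → Transpose s t → col s r ≡ c → col t c ≡ r →
        Transpose (add r ∷ s) (add c ∷ t)
  del : ∀ {n r c} {s t : Vec Step n} → Transpose s t → col s r ≡ suc c → col t c ≡ suc r →
        Transpose (del r ∷ s) (del c ∷ t)

transpose-sym : ∀ {n} {s t : Vec Step n} → Transpose s t → Transpose t s
transpose-sym []          = []
transpose-sym (add p a b) = add (transpose-sym p) b a
transpose-sym (del p a b) = del (transpose-sym p) b a

transpose-functional : ∀ {n} {s t t′ : Vec Step n} → Transpose s t → Transpose s t′ → t ≡ t′
transpose-functional []          []            = refl
transpose-functional (add p a _) (add p′ a′ _) =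
  cong₂ (λ c t → add c ∷ t) (trans (sym a) a′) (transpose-functional p p′)
transpose-functional (del p a _) (del p′ a′ _) =
  cong₂ (λ c t → del c ∷ t) (suc-injective (trans (sym a) a′)) (transpose-functional p p′)

transpose-conj : ∀ {n} {s t : Vec Step n} → Transpose s t → Conj (col s) (col t)
transpose-conj []          = conj (λ ()) (λ ())
transpose-conj (add p a b) = conj-add (transpose-conj p) a b
transpose-conj (del p a b) = conj-del (transpose-conj p) a b

transpose-exists : ∀ {n} (s : Vec Step n) → Osc s → ∃ λ t → Transpose s t × Osc t
transpose-exists []          o = [] , [] , tt
transpose-exists (add r ∷ s) (ad , o)
  with t , p , o′ ← transpose-exists s o
  with corner , ad′ ← conj-addable (transpose-conj p) ad = _ , add p refl corner , ad′ , o′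
transpose-exists (del r ∷ s) (rm , o)
  with t , p , o′ ← transpose-exists s o
  with c , a , b , rm′ ← conj-removable (transpose-conj p) rm = _ , del p a b , rm′ , o′

index : Step → ℕ
index (add i) = i
index (del i) = i

Narrow : ℕ → ∀ {n} → Vec Step n → Set
Narrow k = All (λ x → index x < k)

-- The first column grows only by a box in column 0, and its height is then one more than the index
-- of the row of that box.
narrow-low : ∀ {k n} {s t : Vec Step n} → Transpose s t → Narrow k s → Low k t
narrow-low []          []       = tt
narrow-low {t = _ ∷ t} (add {c = zero} p a b)  (r<k ∷ ps) = ≤-trans (≤-reflexive (cong suc b)) r<k , narrow-low p ps
narrow-low {t = _ ∷ t} (add {c = suc _} p a b) (r<k ∷ ps) = low-col t (narrow-low p ps) , narrow-low p ps
narrow-low {t = _ ∷ t} (del {c = c} p a b)     (r<k ∷ ps) =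
  ≤-trans (m∸n≤m _ (δ 0 c)) (low-col t (narrow-low p ps)) , narrow-low p ps

desc-≤ : ∀ {f} → Desc f → ∀ c → f c ≤ f 0
desc-≤ d zero    = ≤-refl
desc-≤ d (suc c) = ≤-trans (d c) (desc-≤ d c)

low-narrow : ∀ {k n} {s t : Vec Step n} → Transpose s t → Osc t → Low k t → Narrow k s
low-narrow []          o l = []
low-narrow {t = _ ∷ t} (add {c = zero} p a b) (_ , o) (h , l) =
  ≤-trans (≤-reflexive (cong suc (sym b))) h ∷ low-narrow p o l
low-narrow {t = _ ∷ t} (add {c = suc c} p a b) (ad , o) (_ , l) =
  ≤-trans (≤-reflexive (cong suc (sym b)))
    (≤-trans (ad c refl) (≤-trans (desc-≤ (osc-desc t o) c) (low-col t l))) ∷ low-narrow p o l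
low-narrow {t = _ ∷ t} (del {c = c} p a b) (_ , o) (_ , l) =
  ≤-trans (≤-reflexive (sym b)) (≤-trans (desc-≤ (osc-desc t o) c) (low-col t l)) ∷ low-narrow p o l

ray : ℕ → ℕ → ℕ
ray m zero    = m
ray m (suc r) = 0

ray-conj : ∀ m → Conj (ray m) (below m)
ray-conj m = conj (i m) (b m)
  where
  i : ∀ m {r c} → r < below m c → c < ray m r
  i (suc m) {zero}  {zero}  _  = s≤s z≤n
  i (suc m) {zero}  {suc c} lt = s≤s (i m lt)
  i (suc m) {suc r} {zero}  (s≤s ())
  i (suc m) {suc r} {suc c} lt = ⊥-elim (n≮0 (i m lt))
  b : ∀ m {r c} → c < ray m r → r < below m c
  b (suc m) {zero}  {zero}  _        = s≤s z≤n
  b (suc m) {zero}  {suc c} (s≤s lt) = b m lt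

Ray : ∀ {n} → Vec Step n → Set
Ray s = ∃ λ m → ∀ r → col s r ≡ ray m r

conj-≗ : ∀ {f f′ g g′} → (∀ r → f r ≡ f′ r) → (∀ c → g c ≡ g′ c) → Conj f g → Conj f′ g′
conj-≗ ff gg (conj i b) = conj (λ {r} {c} lt → subst (c <_) (ff r) (i (subst (r <_) (sym (gg c)) lt)))
                                (λ {r} {c} lt → subst (r <_) (gg c) (b (subst (c <_) (sym (ff r)) lt)))

NarrowRay : ℕ → ∀ {n} → Vec Step n → Set
NarrowRay k s = Osc s × Narrow k s × Ray s

transposes : ∀ {k n} → BijRel (NarrowRay k {n}) (OscRow k {n}) Transpose
transposes {k} {n} = record
  { to = to ; from = from
  ; functional = λ _ _ _ → transpose-functional
  ; injective  = λ _ _ _ p q → transpose-functional (transpose-sym p) (transpose-sym q) }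
  where
  to : ∀ {s : Vec Step n} → NarrowRay k s → ∃ λ t → OscRow k t × Transpose s t
  to {s} (o , nw , m , eq) with t , p , o′ ← transpose-exists s o =
    t , (o′ , narrow-low p nw , m , conj-unique (conj-sym (transpose-conj p))
          (conj-sym (conj-≗ (λ r → sym (eq r)) (λ _ → refl) (ray-conj m)))) , p
  from : ∀ {t : Vec Step n} → OscRow k t → ∃ λ s → NarrowRay k s × Transpose s t
  from {t} (o , l , m , eq) with s , p , o′ ← transpose-exists t o =
    s , (o′ , low-narrow (transpose-sym p) o l , m , conj-unique (conj-sym (transpose-conj p))
          (conj-≗ (λ _ → refl) (λ c → sym (eq c)) (ray-conj m))) , transpose-sym p

-- Walks as sequences of steps

-- The point `start k` translated by `f`, which turns the chamber into the cone of partitions.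
pt : ∀ k → (ℕ → ℕ) → Point k
pt zero    f = []
pt (suc k) f = ℤ.+ (suc k + f 0) ∷ pt k (f ∘ suc)

pt-≗ : ∀ k {f g} → (∀ r → f r ≡ g r) → pt k f ≡ pt k g
pt-≗ zero    eq = refl
pt-≗ (suc k) eq = cong₂ (λ m v → ℤ.+ (suc k + m) ∷ v) (eq 0) (pt-≗ k (eq ∘ suc))

pt-injective : ∀ k {f g} → pt k f ≡ pt k g → ∀ r → r < k → f r ≡ g r
pt-injective (suc k) eq zero    _         = +-cancelˡ-≡ (suc k) _ _ (ℤₚ.+-injective (proj₁ (∷-injective eq)))
pt-injective (suc k) eq (suc r) (s≤s r<k) = pt-injective k (proj₂ (∷-injective eq)) r r<k

start-pt : ∀ k → start k ≡ pt k (λ _ → 0)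
start-pt zero    = refl
start-pt (suc k) = cong₂ (λ m v → ℤ.+ m ∷ v) (sym (+-identityʳ (suc k))) (start-pt k)

pt-⊕-zero : ∀ k f (z : Fin k → ℤ) → (∀ i → z i ≡ ℤ.+ 0) → pt k f ⊕ tabulate z ≡ pt k f
pt-⊕-zero zero    f z eq = refl
pt-⊕-zero (suc k) f z eq = cong₂ _∷_ (trans (cong (λ c → ℤ.+ (suc k + f 0) ℤ.+ c) (eq zero)) (ℤₚ.+-identityʳ _))
                                     (pt-⊕-zero k (f ∘ suc) (z ∘ suc) (eq ∘ suc))

pt-add : ∀ k f (i : Fin k) → pt k f ⊕ e i ≡ pt k (λ r → δ r (toℕ i) + f r)
pt-add (suc k) f zero    = cong₂ _∷_ (cong ℤ.+_ (trans (+-comm (suc k + f 0) 1) (sym (+-suc (suc k) (f 0)))))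
                                     (pt-⊕-zero k (f ∘ suc) _ (λ _ → refl))
pt-add (suc k) f (suc i) = cong₂ _∷_ (ℤₚ.+-identityʳ _) (pt-add k (f ∘ suc) i)

pt-⊕-neg-zero : ∀ k f → pt k f ⊕ map ℤ.-_ (tabulate (λ _ → ℤ.+ 0)) ≡ pt k f
pt-⊕-neg-zero k f = trans (cong (pt k f ⊕_) (sym (tabulate-∘ ℤ.-_ (λ _ → ℤ.+ 0)))) (pt-⊕-zero k f _ (λ _ → refl))

pt-del : ∀ k f (i : Fin k) → 0 < f (toℕ i) → pt k f ⊕ map ℤ.-_ (e i) ≡ pt k (λ r → f r ∸ δ r (toℕ i))
pt-del (suc k) f zero    pos = cong₂ _∷_ (cong ℤ.+_ (+-∸-assoc (suc k) pos)) (pt-⊕-neg-zero k (f ∘ suc))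
pt-del (suc k) f (suc i) pos = cong₂ _∷_ (ℤₚ.+-identityʳ _) (pt-del k (f ∘ suc) i pos)

-- Even after the step the coordinate must exceed the next one, or 0 if it is the last. This makes
-- the truncated subtraction in `col` exact.
del-positive : ∀ k f (i : Fin k) → InW (pt k f ⊕ map ℤ.-_ (e i)) → 0 < f (toℕ i)
del-positive (suc zero)    f zero    (_ , +<+ lt ∷ _) = lt
del-positive (suc (suc k)) f zero    (+<+ lt ∷ _ , _) =
  ≤-<-trans z≤n (+-cancelˡ-< (suc k) (f 1) (f 0) (≤-trans (s≤s (≤-reflexive (sym (+-identityʳ _)))) lt))
del-positive (suc (suc k)) f (suc i) (_ ∷ l , _ ∷ a) = del-positive (suc k) (f ∘ suc) i (l , a)

desc-inside : ∀ k f → Desc f → InW (pt k f)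
desc-inside k f d = linked k f d , positive k f
  where
  positive : ∀ k f → All (λ x → ℤ.+ 0 ℤ.< x) (pt k f)
  positive zero    f = []
  positive (suc k) f = +<+ (s≤s z≤n) ∷ positive k (f ∘ suc)
  linked : ∀ k f → Desc f → Linked ℤ._>_ (pt k f)
  linked zero          f d = []
  linked (suc zero)    f d = [-]
  linked (suc (suc k)) f d = +<+ (s≤s (+-monoʳ-≤ (suc k) (d 0))) ∷ linked (suc k) (f ∘ suc) (d ∘ suc)

inside-desc : ∀ k f → (∀ r → k ≤ r → f r ≡ 0) → InW (pt k f) → Desc f
inside-desc zero          f z w i       = ≤-trans (≤-reflexive (z (suc i) z≤n)) z≤n
inside-desc (suc zero)    f z w zero    = ≤-trans (≤-reflexive (z 1 ≤-refl)) z≤n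
inside-desc (suc (suc k)) f z (+<+ lt ∷ _ , _) zero = +-cancelˡ-≤ (suc k) _ _ (s≤s⁻¹ lt)
inside-desc (suc k)       f z (l , _ ∷ a) (suc i) =
  inside-desc k (f ∘ suc) (λ r le → z (suc r) (s≤s le)) (Linked.tail l , a) i

-- Walks in order of time and newest-first sequences.

module _ {k : ℕ} {S : Set} (disp : S → Point k) where

  pos : ∀ {n} → Vec S n → Point k
  pos []      = start k
  pos (t ∷ s) = pos s ⊕ disp t

  Inside : ∀ {n} → Vec S n → Set
  Inside []      = InW (start k)
  Inside (t ∷ s) = InW (pos (t ∷ s)) × Inside s

  positions-∷ʳ : ∀ {n} p (v : Vec S n) t →
    positions disp p (v ∷ʳ t) ≡ positions disp p v ∷ʳ (last (positions disp p v) ⊕ disp t)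
  positions-∷ʳ p []      t = refl
  positions-∷ʳ p (x ∷ v) t = cong (p ∷_) (positions-∷ʳ (p ⊕ disp x) v t)

  last-positions : ∀ {n} (s : Vec S n) → last (positions disp (start k) (reverse s)) ≡ pos s
  last-positions []      = refl
  last-positions (t ∷ s) = begin
    last (positions disp (start k) (reverse (t ∷ s)))
      ≡⟨ cong (last ∘ positions disp (start k)) (reverse-∷ t s) ⟩
    last (positions disp (start k) (reverse s ∷ʳ t))
      ≡⟨ cong last (positions-∷ʳ (start k) (reverse s) t) ⟩
    last (positions disp (start k) (reverse s) ∷ʳ (last (positions disp (start k) (reverse s)) ⊕ disp t))
      ≡⟨ last-∷ʳ _ (positions disp (start k) (reverse s)) ⟩
    last (positions disp (start k) (reverse s)) ⊕ disp t
      ≡⟨ cong (_⊕ disp t) (last-positions s) ⟩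
    pos s ⊕ disp t ∎
    where open ≡-Reasoning

  all-∷ʳ : ∀ {A : Set} {P : A → Set} {n} (xs : Vec A n) {x} → All P xs → P x → All P (xs ∷ʳ x)
  all-∷ʳ []       []       q = q ∷ []
  all-∷ʳ (_ ∷ xs) (p ∷ ps) q = p ∷ all-∷ʳ xs ps q

  ∷ʳ-all : ∀ {A : Set} {P : A → Set} {n} (xs : Vec A n) {x} → All P (xs ∷ʳ x) → All P xs × P x
  ∷ʳ-all []       (q ∷ []) = [] , q
  ∷ʳ-all (_ ∷ xs) (p ∷ ps) with qs , q ← ∷ʳ-all xs ps = p ∷ qs , q

  positions-reverse-∷ : ∀ {n} t (s : Vec S n) →
    positions disp (start k) (reverse (t ∷ s)) ≡ positions disp (start k) (reverse s) ∷ʳ pos (t ∷ s)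
  positions-reverse-∷ t s = trans (cong (positions disp (start k)) (reverse-∷ t s))
    (trans (positions-∷ʳ (start k) (reverse s) t)
      (cong (λ p → positions disp (start k) (reverse s) ∷ʳ (p ⊕ disp t)) (last-positions s)))

  inside-positions : ∀ {n} (s : Vec S n) → Inside s → All InW (positions disp (start k) (reverse s))
  inside-positions []      i       = i ∷ []
  inside-positions (t ∷ s) (i , is) = subst (All InW) (sym (positions-reverse-∷ t s))
    (all-∷ʳ (positions disp (start k) (reverse s)) (inside-positions s is) i)

  positions-inside : ∀ {n} (s : Vec S n) → All InW (positions disp (start k) (reverse s)) → Inside s
  positions-inside []      (i ∷ []) = i
  positions-inside (t ∷ s) a
    with as , i ← ∷ʳ-all (positions disp (start k) (reverse s)) (subst (All InW) (positions-reverse-∷ t s) a)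
    = i , positions-inside s as

-- An interface that lets both step sets share the translation below.
data StepOf {k : ℕ} : Step → Point k → Set where
  add : ∀ i → StepOf (add (toℕ i)) (e i)
  del : ∀ i → StepOf (del (toℕ i)) (map ℤ.-_ (e i))

module _ {k : ℕ} {S : Set} (disp : S → Point k) (code : S → Step)
         (code-step : ∀ x → StepOf (code x) (disp x)) where

  codes : ∀ {n} → Vec S n → Vec Step n
  codes = map code

  col-≥ : ∀ {n} (s : Vec S n) r → k ≤ r → col (codes s) r ≡ 0
  col-≥ []      r k≤r = refl
  col-≥ (x ∷ s) r k≤r with code x | disp x | code-step x
  ... | _ | _ | add i = cong₂ _+_ (δ-≢ {r} {toℕ i} (λ e → <⇒≱ (toℕ<n i) (subst (k ≤_) e k≤r))) (col-≥ s r k≤r)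
  ... | _ | _ | del i = trans (cong (_∸ δ r (toℕ i)) (col-≥ s r k≤r)) (0∸n≡0 (δ r (toℕ i)))

  osc-pos : ∀ {n} (s : Vec S n) → Osc (codes s) → pos disp s ≡ pt k (col (codes s))
  osc-pos []      o = start-pt k
  osc-pos (x ∷ s) o with code x | disp x | code-step x
  ... | _ | _ | add i = trans (cong (_⊕ e i) (osc-pos s (proj₂ o))) (pt-add k _ i)
  ... | _ | _ | del i = trans (cong (_⊕ map ℤ.-_ (e i)) (osc-pos s (proj₂ o)))
                              (pt-del k _ i (≤-<-trans z≤n (proj₁ o)))

  osc-inside : ∀ {n} (s : Vec S n) → Osc (codes s) → Inside disp s
  osc-inside []      o = subst InW (sym (start-pt k)) (desc-inside k _ (λ _ → z≤n))
  osc-inside (x ∷ s) o = subst InW (sym (osc-pos (x ∷ s) o)) (desc-inside k _ (osc-desc (codes (x ∷ s)) o)) ,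
                         osc-inside s (tail (code x) o)
    where
    tail : ∀ c → Osc (c ∷ codes s) → Osc (codes s)
    tail (add _) = proj₂
    tail (del _) = proj₂

  inside-osc : ∀ {n} (s : Vec S n) → Inside disp s → Osc (codes s)
  inside-osc []      i = tt
  inside-osc (x ∷ s) (i , is) with o ← inside-osc s is | beyond ← col-≥ (x ∷ s)
                              with code x | disp x | code-step x
  ... | _ | _ | add j = desc-addable (inside-desc k _ beyond
          (subst InW (trans (cong (_⊕ e j) (osc-pos s o)) (pt-add k _ j)) i)) (λ _ → refl) , o
  ... | _ | _ | del j = rm , o
    where
    f = col (codes s)
    i′ : InW (pt k f ⊕ map ℤ.-_ (e j))
    i′ = subst (λ p → InW (p ⊕ map ℤ.-_ (e j))) (osc-pos s o) i
    pos′ = del-positive k f j i′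
    d : Desc (λ r → f r ∸ δ r (toℕ j))
    d = inside-desc k _ beyond (subst InW (pt-del k f j pos′) i′)
    rm : Removable f (toℕ j)
    rm = subst₂ (λ a b → suc (f (suc (toℕ j)) ∸ a) ≤ b) (δ-≢ {suc (toℕ j)} {toℕ j} 1+n≢n)
           (m+[n∸m]≡n pos′) (s≤s (subst (λ a → f (suc (toℕ j)) ∸ δ (suc (toℕ j)) (toℕ j) ≤ f (toℕ j) ∸ a) (δ-refl (toℕ j)) (d (toℕ j))))

-- Composing bijections between subsets.

bijrel-sym : ∀ {A B : Set} {P : A → Set} {Q : B → Set} {R : A → B → Set} →
  BijRel P Q R → BijRel Q P (λ b a → R a b)
bijrel-sym r = record
  { to = from ; from = to
  ; functional = λ q p p′ → injective p p′ q
  ; injective  = λ q q′ p → functional p q q′ }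
  where open BijRel r

bijrel-trans : ∀ {A B C : Set} {P : A → Set} {Q : B → Set} {O : C → Set} {R : A → B → Set} {S : B → C → Set} →
  BijRel P Q R → BijRel Q O S → BijRel P O (λ a c → ∃ λ b → Q b × R a b × S b c)
bijrel-trans {R = R} {S} r s = record
  { to = λ p → let b , q , x = r.to p ; c , o , y = s.to q in c , o , b , q , x , y
  ; from = λ o → let b , q , y = s.from o ; a , p , x = r.from q in a , p , b , q , x , y
  ; functional = λ { p o o′ (b , q , x , y) (b′ , q′ , x′ , y′) →
      s.functional q o o′ y (subst (λ z → S z _) (r.functional p q′ q x′ x) y′) }
  ; injective = λ { p p′ o (b , q , x , y) (b′ , q′ , x′ , y′) →
      r.injective p p′ q x (subst (R _) (s.injective q′ q o y′ y) x′) } }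
  where module r = BijRel r
        module s = BijRel s

-- Irrelevance reduces each round trip to an equation of first components, which `functional` or
-- `injective` supplies.
bijrel-↔ : ∀ {A B : Set} {P : A → Set} {Q : B → Set} {R : A → B → Set} → BijRel P Q R →
  (∀ {a} → Irrelevant (P a)) → (∀ {b} → Irrelevant (Q b)) → Σ A P ↔ Σ B Q
bijrel-↔ {P = P} {Q} r irrP irrQ = mk↔ₛ′
  (λ { (a , p) → let b , q , _ = to p in b , q })
  (λ { (b , q) → let a , p , _ = from q in a , p })
  (λ { (b , q) → let a , p , x = from q ; b′ , q′ , x′ = to p in Σ-≡ irrQ (functional p q′ q x′ x) })
  (λ { (a , p) → let b , q , x = to p ; a′ , p′ , x′ = from q in Σ-≡ irrP (injective p′ p q x′ x) })
  where
  open BijRel r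
  Σ-≡ : ∀ {A : Set} {P : A → Set} → (∀ {a} → Irrelevant (P a)) → {x y : Σ A P} → proj₁ x ≡ proj₁ y → x ≡ y
  Σ-≡ irr {a , p} {_ , p′} refl = cong (a ,_) (irr p p′)

-- The two families of walks.

pmCode : ∀ {k} → PMStep k → Step
pmCode (i , true)  = add (toℕ i)
pmCode (i , false) = del (toℕ i)

pmCode-step : ∀ {k} (x : PMStep k) → StepOf (pmCode x) (pmDisp x)
pmCode-step (i , true)  = add i
pmCode-step (i , false) = del i

pmCode-injective : ∀ {k} {x y : PMStep k} → pmCode x ≡ pmCode y → x ≡ y
pmCode-injective {x = i , true}  {j , true}  eq = cong (_, true) (toℕ-injective (cong index eq))
pmCode-injective {x = i , false} {j , false} eq = cong (_, false) (toℕ-injective (cong index eq))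

pmCode-narrow : ∀ {k n} (s : Vec (PMStep k) n) → Narrow k (map pmCode s)
pmCode-narrow []                = []
pmCode-narrow ((i , true) ∷ s)  = toℕ<n i ∷ pmCode-narrow s
pmCode-narrow ((i , false) ∷ s) = toℕ<n i ∷ pmCode-narrow s

pmCode-lift : ∀ {k n} (s : Vec Step n) → Narrow k s → ∃ λ v → s ≡ map (pmCode {k}) v
pmCode-lift []          []         = [] , refl
pmCode-lift (add c ∷ s) (c<k ∷ nw) with v , eq ← pmCode-lift s nw =
  (fromℕ< c<k , true) ∷ v , cong₂ _∷_ (cong add (sym (toℕ-fromℕ< c<k))) eq
pmCode-lift (del c ∷ s) (c<k ∷ nw) with v , eq ← pmCode-lift s nw =
  (fromℕ< c<k , false) ∷ v , cong₂ _∷_ (cong del (sym (toℕ-fromℕ< c<k))) eq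

toℕ-lift : ∀ {k n} (u : Vec ℕ n) → All (_< k) u → ∃ λ v → u ≡ map (toℕ {k}) v
toℕ-lift []      []         = [] , refl
toℕ-lift (x ∷ u) (x<k ∷ lt) with v , eq ← toℕ-lift u lt =
  fromℕ< x<k ∷ v , cong₂ _∷_ (sym (toℕ-fromℕ< x<k)) eq

toℕ-< : ∀ {k n} (v : Vec (Fin k) n) → All (_< k) (map toℕ v)
toℕ-< []      = []
toℕ-< (i ∷ v) = toℕ<n i ∷ toℕ-< v

ray-pt : ∀ k m → 1 ≤ k → start k ⊕ map (λ c → ℤ.+ m ℤ.* c) (e₁ k) ≡ pt k (ray m)
ray-pt (suc k) m _ = cong₂ _∷_
  (cong (λ z → ℤ.+ suc k ℤ.+ z) (ℤₚ.*-identityʳ (ℤ.+ m)))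
  (trans (cong₂ _⊕_ (start-pt k) (sym (tabulate-∘ (λ c → ℤ.+ m ℤ.* c) (λ _ → ℤ.+ 0))))
    (pt-⊕-zero k (λ _ → 0) _ (λ _ → ℤₚ.*-zeroʳ (ℤ.+ m))))

ray-≥ : ∀ {k r} m → 1 ≤ k → k ≤ r → ray m r ≡ 0
ray-≥ {r = zero}  m 1≤k k≤r = ⊥-elim (n≮0 (≤-trans 1≤k k≤r))
ray-≥ {r = suc _} m _   _   = refl

RayWalk : ∀ k {n} → Vec (PMStep k) n → Set
RayWalk k v = All InW (positions pmDisp (start k) v) × OnRay k (last (positions pmDisp (start k) v))

rayWalks : ∀ {k n} → 1 ≤ k → BijRel (RayWalk k {n}) (NarrowRay k {n}) (λ v s → s ≡ map pmCode (reverse v))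
rayWalks {k} {n} 1≤k = record
  { to = to ; from = from
  ; functional = λ _ _ _ p q → trans p (sym q)
  ; injective  = λ _ _ _ p q → reverse-injective (map-injective pmCode-injective (trans (sym p) q)) }
  where
  to : ∀ {v : Vec (PMStep k) n} → RayWalk k v → ∃ λ s → NarrowRay k s × s ≡ map pmCode (reverse v)
  -- `v` is replaced by `reverse s`, the form in which the lemmas on newest-first sequences apply.
  to {v} w with s ← reverse v in eq with refl ← trans (sym (reverse-involutive v)) (cong reverse eq)
           with a , m , ends ← w = map pmCode s , (osc , pmCode-narrow s , m , rows) , refl
    where
    osc = inside-osc pmDisp pmCode pmCode-step s (positions-inside pmDisp s a)
    rows : ∀ r → col (map pmCode s) r ≡ ray m r
    rows r with r <? k
    ... | yes r<k = pt-injective k (trans (sym (osc-pos pmDisp pmCode pmCode-step s osc))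
                      (trans (sym (last-positions pmDisp s)) (trans ends (ray-pt k m 1≤k)))) r r<k
    ... | no  r≮k = trans (col-≥ pmDisp pmCode pmCode-step s r (≮⇒≥ r≮k)) (sym (ray-≥ m 1≤k (≮⇒≥ r≮k)))
  from : ∀ {s : Vec Step n} → NarrowRay k s → ∃ λ v → RayWalk k v × s ≡ map pmCode (reverse v)
  from {s} (o , nw , m , rows) with v , refl ← pmCode-lift s nw =
    reverse v , (inside-positions pmDisp v (osc-inside pmDisp pmCode pmCode-step v o) , m , ends)
    , cong (map pmCode) (sym (reverse-involutive v))
    where
    ends = trans (last-positions pmDisp v) (trans (osc-pos pmDisp pmCode pmCode-step v o)
             (trans (pt-≗ k rows) (sym (ray-pt k m 1≤k))))

col-add : ∀ {n} (u : Vec ℕ n) i → col (map Step.add u) i ≡ occ u i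
col-add []      i = refl
col-add (x ∷ u) i = cong (δ i x +_) (col-add u i)

osc-yam : ∀ {n} (u : Vec ℕ n) → Osc (map Step.add u) → Yam #● (map ● u)
osc-yam []      o = λ _ → z≤n
osc-yam (x ∷ u) o = desc-≗ (col-add (x ∷ u)) (osc-desc (map Step.add (x ∷ u)) o) , osc-yam u (proj₂ o)

yam-osc : ∀ {n} (u : Vec ℕ n) → Yam #● (map ● u) → Osc (map Step.add u)
yam-osc []      y       = tt
yam-osc (x ∷ u) (d , y) = desc-addable (desc-≗ (λ i → sym (col-add (x ∷ u) i)) d) (λ _ → refl) , yam-osc u y

FreeWalk : ∀ k {n} → Vec (PStep k) n → Set
FreeWalk k v = All InW (positions pDisp (start k) v) × Anywhere (last (positions pDisp (start k) v))

dbl-+ : ∀ k → dbl k ≡ k + k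
dbl-+ zero    = refl
dbl-+ (suc k) = cong suc (trans (cong suc (dbl-+ k)) (sym (+-suc k k)))

freeWalks : ∀ {k n} → BijRel (FreeWalk (k + k) {n}) (SYT k {n}) (λ v u → u ≡ map toℕ (reverse v))
freeWalks {k} {n} = record
  { to = to ; from = from
  ; functional = λ _ _ _ p q → trans p (sym q)
  ; injective  = λ _ _ _ p q → reverse-injective (map-injective toℕ-injective (trans (sym p) q)) }
  where
  K = k + k
  code : PStep K → Step
  code i = add (toℕ i)
  to : ∀ {v : Vec (PStep K) n} → FreeWalk K v → ∃ λ u → SYT k u × u ≡ map toℕ (reverse v)
  to {v} (a , _) = map toℕ s , (osc-yam (map toℕ s) osc , subst (λ c → All (_< c) (map toℕ s)) (sym (dbl-+ k)) (toℕ-< s)) , refl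
    where
    s = reverse v
    osc : Osc (map Step.add (map toℕ s))
    osc = subst Osc (map-∘ Step.add toℕ s) (inside-osc pDisp code add s (positions-inside pDisp s
            (subst (λ z → All InW (positions pDisp (start K) z)) (sym (reverse-involutive v)) a)))
  from : ∀ {u : Vec ℕ n} → SYT k u → ∃ λ v → FreeWalk K v × u ≡ map toℕ (reverse v)
  from {u} (y , small) with v , refl ← toℕ-lift u (subst (λ c → All (_< c) u) (dbl-+ k) small) =
    reverse v , (inside-positions pDisp v (osc-inside pDisp code add v
      (subst Osc (sym (map-∘ Step.add toℕ v)) (yam-osc (map toℕ v) y))) , tt)
    , cong (map toℕ) (sym (reverse-involutive v))

inW-irrelevant : ∀ {k} {x : Point k} → Irrelevant (InW x)
inW-irrelevant (l , a) (l′ , a′) =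
  cong₂ _,_ (Linked.irrelevant ℤₚ.<-irrelevant l l′) (All.irrelevant ℤₚ.<-irrelevant a a′)

-- The first coordinate determines `m`; in dimension 0 every `m` would be a witness.
onRay-irrelevant : ∀ {k} {x : Point k} → 1 ≤ k → Irrelevant (OnRay k x)
onRay-irrelevant {k} 1≤k (m , eq) (m′ , eq′)
  with refl ← pt-injective k {ray m} {ray m′} (trans (sym (ray-pt k m 1≤k)) (trans (sym eq) (trans eq′ (ray-pt k m′ 1≤k)))) 0 1≤k
  = cong (m ,_) (uip eq eq′)

theorem20 : (k n : ℕ) → 1 ≤ k →
    Walk k n (pmDisp {k}) (start k) (OnRay k)
    ↔ Walk (k + k) n (pDisp {k + k}) (start (k + k)) (Anywhere {k + k})
theorem20 k n 1≤k = bijrel-↔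
  (bijrel-trans (rayWalks 1≤k) (bijrel-trans transposes (bijrel-trans corresponds (bijrel-sym freeWalks))))
  (λ { (a , r) (a′ , r′) → cong₂ _,_ (All.irrelevant inW-irrelevant a a′) (onRay-irrelevant 1≤k r r′) })
  (λ { (a , _) (a′ , _) → cong (_, tt) (All.irrelevant inW-irrelevant a a′) })
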